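{- Let $G$ be a 2-connected graph such that the $\mathrm{Gem}$ is not an induced minor of $G$. Then there is a subset $X \subseteq V(G)$ with $|X| \le 6$ such that every connected component of $G \setminus X$ is either a cograph, or a path whose internal vertices all have degree two in $G$.
   Context: Graphs are finite and simple. $H$ is an induced minor of $G$ if $H$ can be obtained from $G$ by vertex deletions and edge contractions. The $\mathrm{Gem}$ is the graph obtained from the path $P_4$ on four vertices by adding a vertex adjacent to all four path vertices. A cograph is a graph that does not contain $P_4$ as an induced subgraph. -}

module Defs where

open import Data.Nat using (ℕ; zero; suc; _≤_; _<_)
open import Data.Bool using (Bool; true; false; _∨_; _∧_; if_then_else_; T)
open import Data.Fin using (Fin; zero; suc; punchIn; toℕ; _≟_)
open import Data.Fin.Subset using (Subset; _∉_; ∣_∣)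
open import Data.Vec using (tabulate)
open import Data.Product using (Σ; _×_; _,_; ∃-syntax)
open import Data.Sum using (_⊎_)
open import Relation.Nullary using (¬_)
open import Relation.Nullary.Decidable using (⌊_⌋)
open import Relation.Binary.PropositionalEquality using (_≡_; _≢_)
open import Relation.Binary.Construct.Closure.ReflexiveTransitive using (Star)
open import Function.Definitions using (Injective)
open import Function.Bundles using (_⇔_)

Adj : ℕ → Set
Adj n = Fin n → Fin n → Bool

record IsSimple {n : ℕ} (G : Adj n) : Set where
  field
    sym   : ∀ x y → G x y ≡ G y x
    irrefl : ∀ x → G x x ≡ false

E : ∀ {n} → Adj n → Fin n → Fin n → Set
E G x y = T (G x y)

degree : ∀ {n} → Adj n → Fin n → ℕ
degree G v = ∣ tabulate (G v) ∣

deleteV : ∀ {n} → Adj (suc n) → Fin (suc n) → Adj n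
deleteV G v x y = G (punchIn v x) (punchIn v y)

-- contract the edge uv (u ≠ v): vertex v is removed and the vertex u
-- becomes adjacent to all former neighbours of v (other than itself).
contract : ∀ {n} → Adj (suc n) → Fin (suc n) → Fin (suc n) → Adj n
contract G u v x y =
  if ⌊ x ≟ y ⌋ then false
  else (G px py ∨ (⌊ px ≟ u ⌋ ∧ G v py) ∨ (⌊ py ≟ u ⌋ ∧ G v px))
  where
    px = punchIn v x
    py = punchIn v y

record Iso {m n : ℕ} (H : Adj m) (G : Adj n) : Set where
  field
    to      : Fin m → Fin n
    from    : Fin n → Fin m
    to-from : ∀ y → to (from y) ≡ y
    from-to : ∀ x → from (to x) ≡ x
    adj     : ∀ x y → H x y ≡ G (to x) (to y)

data _≼_ {m : ℕ} (H : Adj m) : {n : ℕ} → Adj n → Set where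
  iso  : ∀ {n} {G : Adj n} → Iso H G → H ≼ G
  del  : ∀ {n} {G : Adj (suc n)} (v : Fin (suc n)) →
         H ≼ deleteV G v → H ≼ G
  cont : ∀ {n} {G : Adj (suc n)} (u v : Fin (suc n)) →
         u ≢ v → E G u v → H ≼ contract G u v → H ≼ G

-- The Gem: path 0-1-2-3 plus vertex 4 adjacent to all of 0,1,2,3.

gemEdge : Fin 5 → Fin 5 → Bool
gemEdge zero (suc zero) = true
gemEdge (suc zero) (suc (suc zero)) = true
gemEdge (suc (suc zero)) (suc (suc (suc zero))) = true
gemEdge (suc (suc (suc (suc zero)))) zero = true
gemEdge (suc (suc (suc (suc zero)))) (suc zero) = true
gemEdge (suc (suc (suc (suc zero)))) (suc (suc zero)) = true
gemEdge (suc (suc (suc (suc zero)))) (suc (suc (suc zero))) = true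
gemEdge _ _ = false

Gem : Adj 5
Gem x y = gemEdge x y ∨ gemEdge y x

Reach : ∀ {n} → Adj n → Fin n → Fin n → Set
Reach G = Star (E G)

Connected : ∀ {n} → Adj n → Set
Connected G = ∀ x y → Reach G x y

TwoConnected : ∀ {n} → Adj n → Set
TwoConnected {n} G =
  3 ≤ n × Connected G × ((v : Fin n) → ∀ x y → x ≢ v → y ≢ v →
     Star (λ a b → a ≢ v × b ≢ v × E G a b) x y)

EOut : ∀ {n} → Adj n → Subset n → Fin n → Fin n → Set
EOut G X a b = a ∉ X × b ∉ X × E G a b

-- the vertex set of the connected component of G \ X containing v
-- (for v ∉ X)
Component : ∀ {n} → Adj n → Subset n → Fin n → Fin n → Set
Component G X v w = Star (EOut G X) v w

InducedP4In : ∀ {n} → Adj n → (Fin n → Set) → Set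
InducedP4In G S = Σ (Fin _) λ a → Σ (Fin _) λ b → Σ (Fin _) λ c → Σ (Fin _) λ d →
  S a × S b × S c × S d ×
  E G a b × E G b c × E G c d ×
  ¬ E G a c × ¬ E G b d × ¬ E G a d

IsCographOn : ∀ {n} → Adj n → (Fin n → Set) → Set
IsCographOn G S = ¬ InducedP4In G S

IsPathDeg2On : ∀ {n} → Adj n → (Fin n → Set) → Set
IsPathDeg2On {n} G S = Σ ℕ λ k → Σ (Fin k → Fin n) λ p →
  Injective _≡_ _≡_ p ×
  (∀ w → S w ⇔ (∃[ i ] p i ≡ w)) ×
  (∀ i j → E G (p i) (p j) ⇔ (toℕ i ≡ suc (toℕ j) ⊎ toℕ j ≡ suc (toℕ i))) ×
  (∀ i → 0 < toℕ i → suc (toℕ i) < k → degree G (p i) ≡ 2)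

{-# OPTIONS --safe #-}
-- Call two vertices x, z a cut pair if deleting them disconnects G, and call a component W of
-- G − x − z double if it splits into two connected parts that both see x and z.  Gem-freeness
-- forces every vertex of a double component to be adjacent to x and z, and then an induced P₄ in
-- it would form a gem with x.  If W is not double, Menger's theorem gives a vertex c of W that
-- separates x from z inside W; applying the same to the cut pairs {x , c} and {c , z} shows that
-- W is a path of vertices of degree two, unless one of the cut pairs met on the way is adjacent,
-- has three components, or has a double component.
-- If some cut pair {x , z} is of that exceptional kind, then outside any component W that is not
-- double there are two disjoint connections between x and z (one may be the edge), and with these
-- a gem arises from every obstacle to the recursion; so X = {x , z} works.  If cut pairs exist but
-- none is exceptional, both components of any of them are paths.
-- If there is no cut pair, let a b c d be an induced P₄.  Each component of the rest sees exactly
-- three of these four vertices, only the triples abd and acd can occur, and every component is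
-- completely adjacent to a or to d; so X = {a , b , c , d} works.
module Submission where

open import Defs
open import Data.Bool using (Bool; true; false; _∧_; T)
open import Data.Bool.Properties using (T-∨; ∨-comm)
open import Data.Empty using (⊥; ⊥-elim)
open import Data.Fin using (Fin; zero; suc; toℕ; punchIn; punchOut; _≟_)
open import Data.Fin.Patterns using (0F; 1F; 2F; 3F; 4F)
open import Data.Fin.Properties using (any?; suc-injective; punchIn-punchOut; punchOut-punchIn; punchInᵢ≢i)
open import Data.Fin.Subset using (Subset; _∈_; _∉_; _⊆_; _⊂_; _∪_; _─_; _-_; ⁅_⁆; ∁; ∣_∣) renaming (⊥ to ∅)
open import Data.Fin.Subset.Induction using (Acc; acc; ⊂-wellFounded; ⊃-wellFounded)
open import Data.Fin.Subset.Properties using (_∈?_; x∈⁅x⁆; x∈⁅y⁆⇒x≡y; x∈p∪q⁻; p⊆p∪q; q⊆p∪q; p─q⊆p; x∈p∧x∉q⇒x∈p─q; x∈p∧x≢y⇒x∈p-y; ∣⁅x⁆∣≡1; ∣⊥∣≡0; x∉p⇒x∈∁p; x∈∁p⇒x∉p)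
open import Data.List using (List; []; _∷_; _++_; length; lookup)
open import Data.List.Membership.Propositional using () renaming (_∈_ to _∈ˡ_; _∉_ to _∉ˡ_)
open import Data.List.Membership.Propositional.Properties using (∈-++⁻; ∈-++⁺ˡ; ∈-++⁺ʳ; ∈-lookup)
open import Data.List.Relation.Unary.All as All using ([]; _∷_)
open import Data.List.Relation.Unary.AllPairs using ([]; _∷_)
open import Data.List.Relation.Unary.Any as Any using () renaming (here to hereˡ; there to thereˡ)
open import Data.List.Relation.Unary.Any.Properties using (lookup-index)
open import Data.List.Relation.Unary.Unique.Propositional using (Unique)
open import Data.List.Relation.Unary.Unique.Propositional.Properties using (++⁺)
open import Data.Maybe using (Maybe; just; nothing)
open import Data.Maybe.Properties using (just-injective; ≡-dec)
open import Data.Nat using (ℕ; zero; suc; _+_; _≤_; z≤n; s≤s)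
import Data.Nat.Properties as ℕ
open import Data.Product using (Σ; _×_; _,_; ∃; proj₁; proj₂)
open import Data.Sum using (_⊎_; inj₁; inj₂; [_,_]′)
open import Data.Unit using (tt)
open import Data.Vec using (tabulate; here; there; []; _∷_)
open import Function using (_∘_; id)
open import Function.Bundles using (_⇔_; mk⇔; Equivalence)
open import Relation.Binary.Construct.Closure.ReflexiveTransitive as Star using (Star; ε; _◅_; _◅◅_)
open import Relation.Binary.PropositionalEquality using (_≡_; _≢_; refl; sym; trans; cong; subst; ≢-sym)
open import Relation.Nullary using (¬_; Dec; yes; no; contradiction)
open import Relation.Nullary.Decidable using (⌊_⌋; _×-dec_; _⊎-dec_; ¬?; T?)

-- Simple graphs under vertex deletion and edge contraction

E-sym : ∀ {n} {G : Adj n} → IsSimple G → ∀ {x y} → E G x y → E G y x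
E-sym simple {x} {y} = subst T (IsSimple.sym simple x y)

E-irrefl : ∀ {n} {G : Adj n} → IsSimple G → ∀ {x} → ¬ E G x x
E-irrefl simple {x} e = subst T (IsSimple.irrefl simple x) e

E⇒≢ : ∀ {n} {G : Adj n} → IsSimple G → ∀ {x y} → E G x y → x ≢ y
E⇒≢ simple e refl = E-irrefl simple e

T-ext : ∀ {a b} → (T a → T b) → (T b → T a) → a ≡ b
T-ext {true}  {true}  f g = refl
T-ext {true}  {false} f g = ⊥-elim (f tt)
T-ext {false} {true}  f g = ⊥-elim (g tt)
T-ext {false} {false} f g = refl

deleteV-simple : ∀ {n} {G : Adj (suc n)} → IsSimple G → ∀ v → IsSimple (deleteV G v)
deleteV-simple simple v = record
  { sym    = λ x y → IsSimple.sym simple _ _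
  ; irrefl = λ x → IsSimple.irrefl simple _
  }

contract-edge⁻ : ∀ {n} (G : Adj (suc n)) u v {x y} → E (contract G u v) x y →
  x ≢ y × (E G (punchIn v x) (punchIn v y)
           ⊎ (punchIn v x ≡ u × E G v (punchIn v y))
           ⊎ (punchIn v y ≡ u × E G v (punchIn v x)))
contract-edge⁻ G u v {x} {y} e with x ≟ y | punchIn v x ≟ u | punchIn v y ≟ u
... | no x≢y | p | q with Equivalence.to (T-∨ {G (punchIn v x) (punchIn v y)}) e
... | inj₁ e₁ = x≢y , inj₁ e₁
contract-edge⁻ G u v {x} {y} e | no x≢y | yes p | yes q | inj₂ e₂ =
  x≢y , [ (λ e₃ → inj₂ (inj₁ (p , e₃))) , (λ e₃ → inj₂ (inj₂ (q , e₃))) ]′ (Equivalence.to T-∨ e₂)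
contract-edge⁻ G u v {x} {y} e | no x≢y | yes p | no  q | inj₂ e₂ =
  x≢y , [ (λ e₃ → inj₂ (inj₁ (p , e₃))) , (λ ()) ]′ (Equivalence.to T-∨ e₂)
contract-edge⁻ G u v {x} {y} e | no x≢y | no  p | yes q | inj₂ e₂ = x≢y , inj₂ (inj₂ (q , e₂))

contract-edge⁺ : ∀ {n} (G : Adj (suc n)) u v {x y} → x ≢ y →
  E G (punchIn v x) (punchIn v y)
    ⊎ (punchIn v x ≡ u × E G v (punchIn v y))
    ⊎ (punchIn v y ≡ u × E G v (punchIn v x)) →
  E (contract G u v) x y
contract-edge⁺ G u v {x} {y} x≢y e with x ≟ y | punchIn v x ≟ u | punchIn v y ≟ u
... | yes x≡y | _ | _ = contradiction x≡y x≢y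
contract-edge⁺ G u v x≢y (inj₁ e)               | no _ | _ | _ = Equivalence.from T-∨ (inj₁ e)
contract-edge⁺ G u v {x} {y} x≢y (inj₂ (inj₁ (p , e)))  | no _ | yes _ | _ =
  Equivalence.from (T-∨ {G (punchIn v x) (punchIn v y)}) (inj₂ (Equivalence.from T-∨ (inj₁ e)))
contract-edge⁺ G u v x≢y (inj₂ (inj₁ (p , e)))  | no _ | no ¬p | _ = contradiction p ¬p
contract-edge⁺ G u v {x} {y} x≢y (inj₂ (inj₂ (q , e))) | no _ | p | yes _ =
  Equivalence.from (T-∨ {G (punchIn v x) (punchIn v y)}) (inj₂ (Equivalence.from (T-∨ {⌊ p ⌋ ∧ G v (punchIn v y)}) (inj₂ e)))
contract-edge⁺ G u v x≢y (inj₂ (inj₂ (q , e)))  | no _ | _ | no ¬q = contradiction q ¬q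

contract-simple : ∀ {n} {G : Adj (suc n)} → IsSimple G → ∀ u v → IsSimple (contract G u v)
contract-simple {G = G} simple u v = record
  { sym    = λ x y → T-ext flip flip
  ; irrefl = λ x → T-ext (λ e → contradiction refl (proj₁ (contract-edge⁻ G u v {x} {x} e))) ⊥-elim
  }
  where
  flip : ∀ {x y} → E (contract G u v) x y → E (contract G u v) y x
  flip e with contract-edge⁻ G u v e
  ... | x≢y , inj₁ e′        = contract-edge⁺ G u v (≢-sym x≢y) (inj₁ (E-sym simple e′))
  ... | x≢y , inj₂ (inj₁ e′) = contract-edge⁺ G u v (≢-sym x≢y) (inj₂ (inj₂ e′))
  ... | x≢y , inj₂ (inj₂ e′) = contract-edge⁺ G u v (≢-sym x≢y) (inj₂ (inj₁ e′))

-- Branch sets of an induced minor, encoded as a partial labelling: vertices labelled `nothing` are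
-- deleted, and `edge⁻` forbids edges between bags that are not adjacent in `H`. A single labelling
-- makes the bags disjoint by construction.
record Model {m n} (H : Adj m) (G : Adj n) (ℓ : Fin n → Maybe (Fin m)) : Set where
  field
    inhabited : ∀ i → ∃ λ v → ℓ v ≡ just i
    connected : ∀ {u v i} → ℓ u ≡ just i → ℓ v ≡ just i →
                Star (λ a b → ℓ a ≡ just i × ℓ b ≡ just i × E G a b) u v
    edge⁺     : ∀ {i j} → i ≢ j → E H i j → ∃ λ u → ∃ λ v → ℓ u ≡ just i × ℓ v ≡ just j × E G u v
    edge⁻     : ∀ {i j u v} → i ≢ j → ℓ u ≡ just i → ℓ v ≡ just j → E G u v → E H i j

-- ρ is the quotient map of a deletion or a contraction.
Model-map : ∀ {m n n′} {H : Adj m} {G : Adj n} {G′ : Adj n′} {ℓ : Fin n → Maybe (Fin m)}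
  (ι : Fin n′ → Fin n) (ρ : Fin n → Fin n′) →
  (∀ x → ρ (ι x) ≡ x) →
  (∀ {a i} → ℓ a ≡ just i → ℓ (ι (ρ a)) ≡ just i) →
  (∀ {a b i j} → ℓ a ≡ just i → ℓ b ≡ just j → E G a b → ρ a ≡ ρ b ⊎ E G′ (ρ a) (ρ b)) →
  (∀ {x y i j} → ℓ (ι x) ≡ just i → ℓ (ι y) ≡ just j → E G′ x y →
    ∃ λ a → ∃ λ b → ℓ a ≡ just i × ℓ b ≡ just j × E G a b) →
  Model H G ℓ → Model H G′ (ℓ ∘ ι)
Model-map {H = H} {G} {G′} {ℓ} ι ρ ρι label push pull M = record
  { inhabited = λ i → let v , p = inhabited i in ρ v , label p
  ; connected = λ {u} {v} {i} p q →
      subst (λ a → Star (Step i) a v) (ρι u) (subst (Star (Step i) _) (ρι v) (walk (connected p q)))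
  ; edge⁺ = λ i≢j h → let u , v , p , q , e = edge⁺ i≢j h in
      ρ u , ρ v , label p , label q , [ (λ ρu≡ρv → contradiction (sameLabel p q ρu≡ρv) i≢j) , id ]′ (push p q e)
  ; edge⁻ = λ i≢j p q e → let _ , _ , p′ , q′ , e′ = pull p q e in edge⁻ i≢j p′ q′ e′
  }
  where
  open Model M
  Step : _ → _ → _ → Set
  Step i a b = ℓ (ι a) ≡ just i × ℓ (ι b) ≡ just i × E G′ a b
  walk : ∀ {i a b} → Star (λ a b → ℓ a ≡ just i × ℓ b ≡ just i × E G a b) a b → Star (Step i) (ρ a) (ρ b)
  walk ε = ε
  walk {i} {b = b} ((p , q , e) ◅ s) with push p q e
  ... | inj₁ ρ≡ = subst (λ a → Star (Step i) a (ρ b)) (sym ρ≡) (walk s)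
  ... | inj₂ e′ = (label p , label q , e′) ◅ walk s
  sameLabel : ∀ {a b i j} → ℓ a ≡ just i → ℓ b ≡ just j → ρ a ≡ ρ b → i ≡ j
  sameLabel p q ρ≡ = just-injective (trans (sym (label p)) (trans (cong (ℓ ∘ ι) ρ≡) (label q)))

module _ {n} (v w : Fin (suc n)) (v≢w : v ≢ w) where

  -- Left inverse of `punchIn v`; the vertex `v` itself, which has no preimage, is sent to the place
  -- of `w`. For a contraction `w` is the surviving end of the edge.
  retract : Fin (suc n) → Fin n
  retract a with v ≟ a
  ... | yes _   = punchOut v≢w
  ... | no  v≢a = punchOut v≢a

  retract-punchIn : ∀ x → retract (punchIn v x) ≡ x
  retract-punchIn x with v ≟ punchIn v x
  ... | yes p = contradiction (sym p) (punchInᵢ≢i v x)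
  ... | no  p = punchOut-punchIn v

  punchIn-retract : ∀ {a} → v ≢ a → punchIn v (retract a) ≡ a
  punchIn-retract {a} v≢a with v ≟ a
  ... | yes p = contradiction p v≢a
  ... | no  p = punchIn-punchOut p

  punchIn-retract-v : punchIn v (retract v) ≡ w
  punchIn-retract-v with v ≟ v
  ... | yes _ = punchIn-punchOut v≢w
  ... | no  p = contradiction refl p

Model-deleteV : ∀ {m n} {H : Adj (suc m)} {G : Adj (suc n)} {ℓ} v → ℓ v ≡ nothing →
  Model H G ℓ → Model H (deleteV G v) (ℓ ∘ punchIn v)
Model-deleteV {H = H} {G} {ℓ} v ℓv≡∅ M = Model-map {H = H} {G} {deleteV G v} {ℓ} (punchIn v) (retract v w v≢w) (retract-punchIn v w v≢w)
  (λ p → trans (cong ℓ (back p)) p)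
  (λ {a} {b} p q e → inj₂ (subst (λ c → E G c _) (sym (back p)) (subst (E G a) (sym (back q)) e)))
  (λ p q e → _ , _ , p , q , e)
  M
  where
  labelled : ∀ {a i} → ℓ a ≡ just i → v ≢ a
  labelled p refl with trans (sym p) ℓv≡∅
  ... | ()
  -- `retract` needs a target other than `v`; any labelled vertex will do, and one exists because
  -- `H` has a vertex.
  w = proj₁ (Model.inhabited M zero)
  v≢w = labelled (proj₂ (Model.inhabited M zero))
  back : ∀ {a i} → ℓ a ≡ just i → punchIn v (retract v w v≢w a) ≡ a
  back p = punchIn-retract v w v≢w (labelled p)

-- Both ends carry the same label, so the contraction only merges two vertices of one bag, and every
-- edge of the contracted graph comes from an edge of `G` between the same labels.
Model-contract : ∀ {m n} {H : Adj m} {G : Adj (suc n)} {ℓ} → IsSimple G →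
  ∀ u v → u ≢ v → ℓ u ≡ ℓ v → Model H G ℓ → Model H (contract G u v) (ℓ ∘ punchIn v)
Model-contract {H = H} {G} {ℓ} simple u v u≢v ℓu≡ℓv M = Model-map {H = H} {G} {contract G u v} {ℓ} (punchIn v) ρ (retract-punchIn v u v≢u) label push pull M
  where
  v≢u = ≢-sym u≢v
  ρ = retract v u v≢u
  label′ : ∀ a → ℓ (punchIn v (ρ a)) ≡ ℓ a
  label′ a = byCases (v ≟ a)
    where
    byCases : Dec (v ≡ a) → ℓ (punchIn v (ρ a)) ≡ ℓ a
    byCases (yes refl) = trans (cong ℓ (punchIn-retract-v v u v≢u)) ℓu≡ℓv
    byCases (no v≢a)   = cong ℓ (punchIn-retract v u v≢u v≢a)
  label : ∀ {a i} → ℓ a ≡ just i → ℓ (punchIn v (ρ a)) ≡ just i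
  label p = trans (label′ _) p
  push : ∀ {a b i j} → ℓ a ≡ just i → ℓ b ≡ just j → E G a b → ρ a ≡ ρ b ⊎ E (contract G u v) (ρ a) (ρ b)
  push {a} {b} _ _ e = byCases (ρ a ≟ ρ b) (v ≟ a) (v ≟ b)
    where
    back : ∀ {c} → v ≢ c → punchIn v (ρ c) ≡ c
    back = punchIn-retract v u v≢u
    byCases : Dec (ρ a ≡ ρ b) → Dec (v ≡ a) → Dec (v ≡ b) → ρ a ≡ ρ b ⊎ E (contract G u v) (ρ a) (ρ b)
    byCases (yes p) _ _ = inj₁ p
    byCases (no p) (yes refl) (yes refl) = contradiction refl p
    byCases (no p) (yes refl) (no v≢b) = inj₂ (contract-edge⁺ G u v p
      (inj₂ (inj₁ (punchIn-retract-v v u v≢u , subst (E G v) (sym (back v≢b)) e))))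
    byCases (no p) (no v≢a) (yes refl) = inj₂ (contract-edge⁺ G u v p
      (inj₂ (inj₂ (punchIn-retract-v v u v≢u , subst (E G v) (sym (back v≢a)) (E-sym simple e)))))
    byCases (no p) (no v≢a) (no v≢b) = inj₂ (contract-edge⁺ G u v p
      (inj₁ (subst (λ c → E G c _) (sym (back v≢a)) (subst (E G a) (sym (back v≢b)) e))))
  pull : ∀ {x y i j} → ℓ (punchIn v x) ≡ just i → ℓ (punchIn v y) ≡ just j → E (contract G u v) x y →
    ∃ λ a → ∃ λ b → ℓ a ≡ just i × ℓ b ≡ just j × E G a b
  pull p q e with contract-edge⁻ G u v e
  ... | _ , inj₁ e′              = _ , _ , p , q , e′
  ... | _ , inj₂ (inj₁ (refl , e′)) = v , _ , trans (sym ℓu≡ℓv) p , q , e′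
  ... | _ , inj₂ (inj₂ (refl , e′)) = _ , v , p , trans (sym ℓu≡ℓv) q , E-sym simple e′

-- A bag is connected but has no edge inside, so it is a single vertex; as every vertex lies in a
-- bag, picking the vertex of each bag is a bijection.
Model-iso : ∀ {m n} {H : Adj m} {G : Adj n} {ℓ} → IsSimple H → IsSimple G →
  (∀ v → ℓ v ≢ nothing) → (∀ {u v} → ℓ u ≡ ℓ v → ¬ E G u v) → Model H G ℓ → Iso H G
Model-iso {m} {n} {H} {G} {ℓ} simpleH simpleG total independent M = record
  { to      = to
  ; from    = from
  ; to-from = λ y → injective (proj₂ (inhabited (from y))) (proj₂ (label y))
  ; from-to = λ x → just-injective (trans (sym (proj₂ (label (to x)))) (proj₂ (inhabited x)))
  ; adj     = λ x y → T-ext (forward x y) (backward x y)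
  }
  where
  open Model M
  label : ∀ v → ∃ λ i → ℓ v ≡ just i
  label v with ℓ v in eq
  ... | just i  = i , refl
  ... | nothing = contradiction eq (total v)
  to : Fin m → Fin n
  to i = proj₁ (inhabited i)
  from : Fin n → Fin m
  from v = proj₁ (label v)
  injective : ∀ {u v i} → ℓ u ≡ just i → ℓ v ≡ just i → u ≡ v
  injective p q with connected p q
  ... | ε = refl
  ... | (p′ , q′ , e) ◅ _ = contradiction e (independent (trans p′ (sym q′)))
  forward : ∀ x y → E H x y → E G (to x) (to y)
  forward x y h with edge⁺ (E⇒≢ simpleH h) h
  ... | u , v , p , q , e with injective p (proj₂ (inhabited x)) | injective q (proj₂ (inhabited y))
  ... | refl | refl = e
  backward : ∀ x y → E G (to x) (to y) → E H x y
  backward x y e = edge⁻ (λ { refl → E-irrefl simpleG e }) (proj₂ (inhabited x)) (proj₂ (inhabited y)) e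

-- Induction on the number of vertices of `G`: delete an unlabelled vertex, else contract an edge
-- inside a bag; when neither exists, the model is an isomorphism.
Model⇒≼ : ∀ {m n} {H : Adj (suc m)} {G : Adj n} {ℓ} → IsSimple H → IsSimple G → Model H G ℓ → H ≼ G
Model⇒≼ {n = zero} simpleH simpleG M = iso (Model-iso simpleH simpleG (λ ()) (λ { {()} }) M)
Model⇒≼ {n = suc n} {H} {G} {ℓ} simpleH simpleG M
  with any? (λ v → ≡-dec _≟_ (ℓ v) nothing)
... | yes (v , p) = del v (Model⇒≼ simpleH (deleteV-simple simpleG v) (Model-deleteV v p M))
... | no total
  with any? (λ u → any? (λ v → ≡-dec _≟_ (ℓ u) (ℓ v) ×-dec T? (G u v)))
... | yes (u , v , p , e) =
  cont u v (E⇒≢ simpleG e) e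
    (Model⇒≼ simpleH (contract-simple simpleG u v) (Model-contract simpleG u v (E⇒≢ simpleG e) p M))
... | no independent =
  iso (Model-iso simpleH simpleG (λ v p → total (v , p)) (λ p e → independent (_ , _ , p , e)) M)

-- Finite sets of vertices

infix 4 _#_

_#_ : ∀ {n} → Subset n → Subset n → Set
U # V = ∀ {v} → v ∈ U → v ∉ V

x∉p─q : ∀ {n} {p q : Subset n} → (p ─ q) # q
x∉p─q {p = _ ∷ _} {q = true ∷ q}  (there x∈p─q) (there x∈q) = x∉p─q x∈p─q x∈q
x∉p─q {p = _ ∷ _} {q = false ∷ q} (there x∈p─q) (there x∈q) = x∉p─q x∈p─q x∈q

x∉p-x : ∀ {n} {p : Subset n} {x} → x ∉ p - x
x∉p-x {x = x} x∈ = x∉p─q x∈ (x∈⁅x⁆ x)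

∪-elim : ∀ {n} {p q : Subset n} {x} {A : Set} → (x ∈ p → A) → (x ∈ q → A) → x ∈ p ∪ q → A
∪-elim {p = p} {q} f g = [ f , g ]′ ∘ x∈p∪q⁻ p q

∪ˡ : ∀ {n} {p q : Subset n} → p ⊆ p ∪ q
∪ˡ {q = q} = p⊆p∪q q

∪ʳ : ∀ {n} {p q : Subset n} → q ⊆ p ∪ q
∪ʳ {p = p} {q} = q⊆p∪q p q

⁅⁆-elim : ∀ {n} {x y : Fin n} → x ∈ ⁅ y ⁆ → x ≡ y
⁅⁆-elim {y = y} = x∈⁅y⁆⇒x≡y y

-- Source of most edges below: a walk out of a component must leave it somewhere, and closedness
-- then tells where it goes.
exit : ∀ {n} {R : Fin n → Fin n → Set} {P : Fin n → Set} → (∀ v → Dec (P v)) →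
  ∀ {u w} → Star R u w → P u → ¬ P w → ∃ λ a → ∃ λ b → P a × ¬ P b × R a b
exit P? ε Pu ¬Pw = contradiction Pu ¬Pw
exit P? {u} (_◅_ {j = v} e s) Pu ¬Pw with P? v
... | yes Pv = exit P? s Pv ¬Pw
... | no ¬Pv = u , v , Pu , ¬Pv , e

#-sym : ∀ {n} {U V : Subset n} → U # V → V # U
#-sym dis p q = dis q p

#-∪ˡ : ∀ {n} {U V W : Subset n} → U # W → V # W → U ∪ V # W
#-∪ˡ f g p q = ∪-elim (λ r → f r q) (λ r → g r q) p

#-⊆ : ∀ {n} {U V U′ V′ : Subset n} → U′ ⊆ U → V′ ⊆ V → U # V → U′ # V′
#-⊆ f g dis p q = dis (f p) (g q)

⁅⁆-# : ∀ {n} {x : Fin n} {U : Subset n} → x ∉ U → ⁅ x ⁆ # U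
⁅⁆-# x∉U p q with ⁅⁆-elim p
... | refl = x∉U q

⁅⁆-#-⁅⁆ : ∀ {n} {x y : Fin n} → x ≢ y → ⁅ x ⁆ # ⁅ y ⁆
⁅⁆-#-⁅⁆ x≢y = ⁅⁆-# (x≢y ∘ ⁅⁆-elim)

lookup-injective : ∀ {A : Set} {l : List A} → Unique l → ∀ {i j} → lookup l i ≡ lookup l j → i ≡ j
lookup-injective {l = x ∷ l} (_ ∷ _) {zero} {zero} _ = refl
lookup-injective {l = x ∷ l} (x∉ ∷ _) {zero} {suc j} p = contradiction p (All.lookup x∉ (∈-lookup {xs = l} j))
lookup-injective {l = x ∷ l} (x∉ ∷ _) {suc i} {zero} p = contradiction (sym p) (All.lookup x∉ (∈-lookup {xs = l} i))
lookup-injective {l = x ∷ l} (_ ∷ u) {suc i} {suc j} p = cong suc (lookup-injective u p)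

card-0 : ∀ {n} (f : Fin n → Bool) → (∀ w → ¬ T (f w)) → ∣ tabulate f ∣ ≡ 0
card-0 {zero} f none = refl
card-0 {suc n} f none with f zero in eq
... | true  = contradiction (subst T (sym eq) tt) (none zero)
... | false = card-0 (f ∘ suc) (none ∘ suc)

card-1 : ∀ {n} (f : Fin n → Bool) a → T (f a) → (∀ {w} → T (f w) → w ≡ a) → ∣ tabulate f ∣ ≡ 1
card-1 {suc n} f a fa only with f zero in eq
card-1 {suc n} f zero fa only | true = cong suc (card-0 (f ∘ suc) λ w fw → contradiction (only fw) λ ())
card-1 {suc n} f (suc a) fa only | true = contradiction (only (subst T (sym eq) tt)) λ ()
card-1 {suc n} f zero fa only | false = ⊥-elim (subst T eq fa)
card-1 {suc n} f (suc a) fa only | false = card-1 (f ∘ suc) a fa (suc-injective ∘ only)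

card-2 : ∀ {n} (f : Fin n → Bool) a b → a ≢ b → T (f a) → T (f b) → (∀ {w} → T (f w) → w ≡ a ⊎ w ≡ b) →
  ∣ tabulate f ∣ ≡ 2
card-2 {suc n} f a b a≢b fa fb only with f zero in eq
card-2 f zero zero a≢b _ _ _ | _ = contradiction refl a≢b
card-2 f zero (suc b) _ _ fb only | true =
  cong suc (card-1 (f ∘ suc) b fb λ fw → [ (λ ()) , suc-injective ]′ (only fw))
card-2 f (suc a) zero _ fa _ only | true =
  cong suc (card-1 (f ∘ suc) a fa λ fw → [ suc-injective , (λ ()) ]′ (only fw))
card-2 f (suc a) (suc b) _ _ _ only | true with only (subst T (sym eq) tt)
... | inj₁ ()
... | inj₂ ()
card-2 f zero (suc b) _ fa _ _ | false = ⊥-elim (subst T eq fa)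
card-2 f (suc a) zero _ _ fb _ | false = ⊥-elim (subst T eq fb)
card-2 f (suc a) (suc b) a≢b fa fb only | false =
  card-2 (f ∘ suc) a b (a≢b ∘ cong suc) fa fb λ fw → [ inj₁ ∘ suc-injective , inj₂ ∘ suc-injective ]′ (only fw)

∣∪∣≤ : ∀ {n} (p q : Subset n) → ∣ p ∪ q ∣ ≤ ∣ p ∣ + ∣ q ∣
∣∪∣≤ [] [] = z≤n
∣∪∣≤ (true ∷ p)  (true ∷ q)  = s≤s (ℕ.≤-trans (∣∪∣≤ p q) (ℕ.+-monoʳ-≤ ∣ p ∣ (ℕ.n≤1+n _)))
∣∪∣≤ (true ∷ p)  (false ∷ q) = s≤s (∣∪∣≤ p q)
∣∪∣≤ (false ∷ p) (true ∷ q)  = ℕ.≤-trans (s≤s (∣∪∣≤ p q)) (ℕ.≤-reflexive (sym (ℕ.+-suc ∣ p ∣ ∣ q ∣)))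
∣∪∣≤ (false ∷ p) (false ∷ q) = ∣∪∣≤ p q

∣⁅x⁆∪q∣≤ : ∀ {n k} (x : Fin n) {q : Subset n} → ∣ q ∣ ≤ k → ∣ ⁅ x ⁆ ∪ q ∣ ≤ suc k
∣⁅x⁆∪q∣≤ x {q} q≤k = ℕ.≤-trans (∣∪∣≤ ⁅ x ⁆ q) (ℕ.≤-trans (ℕ.≤-reflexive (cong (_+ ∣ q ∣) (∣⁅x⁆∣≡1 x))) (s≤s q≤k))

-- Connected vertex sets and components

module Graph {n} (G : Adj n) (simple : IsSimple G) where

  E? : ∀ u v → Dec (E G u v)
  E? u v = T? (G u v)

  Esym : ∀ {u v} → E G u v → E G v u
  Esym = E-sym simple

  edge⇒≢ : ∀ {u v} → E G u v → u ≢ v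
  edge⇒≢ = E⇒≢ simple

  Step : Subset n → Fin n → Fin n → Set
  Step S u v = u ∈ S × v ∈ S × E G u v

  Conn : Subset n → Set
  Conn S = ∀ {u v} → u ∈ S → v ∈ S → Star (Step S) u v

  infix 4 _~_ _~?_ _≁_ _⟷_ _⟷?_ _∥_

  _~_ : Fin n → Subset n → Set
  v ~ U = ∃ λ u → u ∈ U × E G v u

  _≁_ : Fin n → Subset n → Set
  v ≁ U = ¬ v ~ U

  _~?_ : ∀ v U → Dec (v ~ U)
  v ~? U = any? (λ u → u ∈? U ×-dec E? v u)

  _⟷_ : Subset n → Subset n → Set
  U ⟷ V = ∃ λ u → u ∈ U × u ~ V

  _⟷?_ : ∀ U V → Dec (U ⟷ V)
  U ⟷? V = any? (λ u → u ∈? U ×-dec u ~? V)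

  _∥_ : Subset n → Subset n → Set
  U ∥ V = ∀ {u v} → u ∈ U → v ∈ V → u ≢ v × ¬ E G u v

  ⟷-sym : ∀ {U V} → U ⟷ V → V ⟷ U
  ⟷-sym (u , u∈U , v , v∈V , e) = v , v∈V , u , u∈U , Esym e

  ⟷-mono : ∀ {U V U′ V′} → U ⊆ U′ → V ⊆ V′ → U ⟷ V → U′ ⟷ V′
  ⟷-mono f g (u , u∈U , v , v∈V , e) = u , f u∈U , v , g v∈V , e

  ~-mono : ∀ {v U U′} → U ⊆ U′ → v ~ U → v ~ U′
  ~-mono f (u , u∈U , e) = u , f u∈U , e

  ~⇒⟷ : ∀ {v U V} → v ∈ U → v ~ V → U ⟷ V
  ~⇒⟷ v∈U v~V = _ , v∈U , v~V

  ⟷⇒~ : ∀ {v U} → ⁅ v ⁆ ⟷ U → v ~ U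
  ⟷⇒~ (u , u∈ , w , w∈U , e) with ⁅⁆-elim u∈
  ... | refl = w , w∈U , e

  reach-mono : ∀ {S S′} → S ⊆ S′ → ∀ {u v} → Star (Step S) u v → Star (Step S′) u v
  reach-mono f = Star.map (λ { (p , q , e) → f p , f q , e })

  reach-sym : ∀ {S u v} → Star (Step S) u v → Star (Step S) v u
  reach-sym = Star.reverse (λ { (p , q , e) → q , p , Esym e })

  conn-from : ∀ {S r} → (∀ {v} → v ∈ S → Star (Step S) r v) → Conn S
  conn-from f u∈S v∈S = reach-sym (f u∈S) ◅◅ f v∈S

  conn-⁅⁆ : ∀ {x} → Conn ⁅ x ⁆
  conn-⁅⁆ p q with ⁅⁆-elim p | ⁅⁆-elim q
  ... | refl | refl = ε

  conn-∪ : ∀ {U V} → Conn U → Conn V → U ⟷ V → Conn (U ∪ V)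
  conn-∪ {U} {V} cU cV (u , u∈U , v , v∈V , e) = conn-from {r = u}
    (∪-elim (λ w∈U → reach-mono ∪ˡ (cU u∈U w∈U))
            (λ w∈V → (∪ˡ u∈U , ∪ʳ {p = U} v∈V , e) ◅ reach-mono (∪ʳ {p = U}) (cV v∈V w∈V)))

  record Component-of (S : Subset n) (v : Fin n) : Set where
    field
      C      : Subset n
      root   : v ∈ C
      sub    : C ⊆ S
      conn   : Conn C
      closed : ∀ {u w} → u ∈ C → w ∈ S → E G u w → w ∈ C

  -- Starts at `v` and absorbs adjacent vertices of `S` one at a time; this stops because subsets of
  -- a finite set cannot increase forever, and being stuck is closedness.
  component : ∀ {S v} → v ∈ S → Component-of S v
  component {S} {v} v∈S = grow ⁅ v ⁆ (⊃-wellFounded ⁅ v ⁆) (x∈⁅x⁆ v)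
    (λ u∈ → subst (_∈ S) (sym (⁅⁆-elim u∈)) v∈S) conn-⁅⁆
    where
    grow : ∀ C → Acc (λ p q → q ⊂ p) C → v ∈ C → C ⊆ S → Conn C → Component-of S v
    grow C (acc rec) v∈C C⊆S cC
      with any? (λ w → w ∈? S ×-dec ¬? (w ∈? C) ×-dec w ~? C)
    ... | yes (w , w∈S , w∉C , w~C) =
      grow (⁅ w ⁆ ∪ C) (rec (∪ʳ {p = ⁅ w ⁆} , w , ∪ˡ (x∈⁅x⁆ w) , w∉C)) (∪ʳ {p = ⁅ w ⁆} v∈C)
        (∪-elim (λ u∈ → subst (_∈ S) (sym (⁅⁆-elim u∈)) w∈S) C⊆S)
        (conn-∪ conn-⁅⁆ cC (~⇒⟷ (x∈⁅x⁆ w) w~C))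
    ... | no stuck = record
      { C = C ; root = v∈C ; sub = C⊆S ; conn = cC ; closed = closed }
      where
      closed : ∀ {u w} → u ∈ C → w ∈ S → E G u w → w ∈ C
      closed {u} {w} u∈C w∈S e with w ∈? C
      ... | yes w∈C = w∈C
      ... | no  w∉C = contradiction (w , w∈S , w∉C , u , u∈C , Esym e) stuck

  module _ {S v} (K : Component-of S v) where
    open Component-of K

    reach⇒∈ : ∀ {w} → Star (Step S) v w → w ∈ C
    reach⇒∈ = go root
      where
      go : ∀ {u w} → u ∈ C → Star (Step S) u w → w ∈ C
      go u∈C ε = u∈C
      go u∈C ((_ , q , e) ◅ s) = go (closed u∈C q e) s

    ∈⇒reach : ∀ {w} → w ∈ C → Star (Step S) v w
    ∈⇒reach w∈C = reach-mono sub (conn root w∈C)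

  reach? : ∀ S u v → Dec (u ∈ S × Star (Step S) u v)
  reach? S u v with u ∈? S
  ... | no u∉S = no (u∉S ∘ proj₁)
  ... | yes u∈S with v ∈? Component-of.C (component u∈S)
  ...   | yes v∈C = yes (u∈S , ∈⇒reach (component u∈S) v∈C)
  ...   | no  v∉C = no (v∉C ∘ reach⇒∈ (component u∈S) ∘ proj₂)

  -- Inside `W` the set `C` can be entered only from `c`. So a walk from outside `C`, cut off at its
  -- first visit to `c`, never enters `C`, and every remaining vertex still reaches `c`.
  conn-─ : ∀ {W C c} → Conn W → c ∈ W → C ⊆ W - c →
    (∀ {u w} → u ∈ C → w ∈ W - c → E G u w → w ∈ C) → Conn (W ─ C)
  conn-─ {W} {C} {c} cW c∈W C⊆ closed = conn-from {r = c}
    (λ w∈ → reach-sym (walk (cW (p─q⊆p W C w∈) c∈W) (x∉p─q w∈)))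
    where
    walk : ∀ {w} → Star (Step W) w c → w ∉ C → Star (Step (W ─ C)) w c
    walk ε _ = ε
    walk {w} (_◅_ {j = w′} (p , q , e) s) w∉C with w ≟ c
    ... | yes refl = ε
    ... | no w≢c = (x∈p∧x∉q⇒x∈p─q p w∉C , x∈p∧x∉q⇒x∈p─q q w′∉C , e) ◅ walk s w′∉C
      where
      w′∉C : w′ ∉ C
      w′∉C w′∈C = w∉C (closed w′∈C (x∈p∧x≢y⇒x∈p-y p w≢c) (Esym e))

  ∥-⊆ : ∀ {U V U′ V′} → U′ ⊆ U → V′ ⊆ V → U ∥ V → U′ ∥ V′
  ∥-⊆ f g ap p q = ap (f p) (g q)

  ∥-sym : ∀ {U V} → U ∥ V → V ∥ U
  ∥-sym ap p q = ≢-sym (proj₁ (ap q p)) , proj₂ (ap q p) ∘ Esym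

  ∥⇒# : ∀ {U V} → U ∥ V → U # V
  ∥⇒# ap p q = proj₁ (ap p q) refl

  ⁅⁆-∥ : ∀ {x U} → x ∉ U → x ≁ U → ⁅ x ⁆ ∥ U
  ⁅⁆-∥ x∉U x≁U p q with ⁅⁆-elim p
  ... | refl = (λ { refl → x∉U q }) , λ e → x≁U (_ , q , e)

  ∥-intro : ∀ {U V} → U # V → ¬ U ⟷ V → U ∥ V
  ∥-intro dis ¬t p q = (λ { refl → dis p q }) , λ e → ¬t (_ , p , _ , q , e)

  -- Gems from five connected vertex sets

  record GemBags : Set where
    field
      hub a b c d : Subset n
      conn-hub : Conn hub
      conn-a   : Conn a
      conn-b   : Conn b
      conn-c   : Conn c
      conn-d   : Conn d
      hub⟷a : hub ⟷ a
      hub⟷b : hub ⟷ b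
      hub⟷c : hub ⟷ c
      hub⟷d : hub ⟷ d
      a⟷b : a ⟷ b
      b⟷c : b ⟷ c
      c⟷d : c ⟷ d
      hub#a : hub # a
      hub#b : hub # b
      hub#c : hub # c
      hub#d : hub # d
      a#b : a # b
      b#c : b # c
      c#d : c # d
      a∥c : a ∥ c
      a∥d : a ∥ d
      b∥d : b ∥ d

  Gem-simple : IsSimple Gem
  Gem-simple = record { sym = λ x y → ∨-comm (gemEdge x y) (gemEdge y x) ; irrefl = λ { 0F → refl ; 1F → refl ; 2F → refl ; 3F → refl ; 4F → refl } }

  -- The bags are pairwise disjoint, so labelling each vertex by its bag gives a model of `Gem`;
  -- they are nonempty because each touches another one.
  GemBags⇒≼ : GemBags → Gem ≼ G
  GemBags⇒≼ bags = Model⇒≼ {ℓ = label} Gem-simple simple (record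
    { inhabited = λ i → let v , v∈ = nonempty i in v , label⁺ v∈
    ; connected = λ {u} {v} {i} p q → Star.map (λ { (p , q , e) → label⁺ p , label⁺ q , e }) (connected i (label⁻ p) (label⁻ q))
    ; edge⁺ = λ {i} {j} i≢j h → let u , u∈ , v , v∈ , e = proj₁ (proj₂ (related i j i≢j)) h in u , v , label⁺ u∈ , label⁺ v∈ , e
    ; edge⁻ = λ {i} {j} i≢j p q e → proj₂ (proj₂ (related i j i≢j)) (_ , label⁻ p , _ , label⁻ q , e)
    })
    where
    open GemBags bags
    bag : Fin 5 → Subset n
    bag 0F = a
    bag 1F = b
    bag 2F = c
    bag 3F = d
    bag 4F = hub
    Related : Fin 5 → Fin 5 → Set
    Related i j = bag i # bag j × (E Gem i j → bag i ⟷ bag j) × (bag i ⟷ bag j → E Gem i j)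
    Related-sym : ∀ i j → Related i j → Related j i
    Related-sym i j (dis , f , g) =
      (λ p q → dis q p) , (λ h → ⟷-sym (f (E-sym Gem-simple {j} {i} h))) , λ t → E-sym Gem-simple {i} {j} (g (⟷-sym t))
    touching : ∀ i j → E Gem i j → bag i # bag j → bag i ⟷ bag j → Related i j
    touching i j h dis t = dis , (λ _ → t) , λ _ → h
    apart : ∀ i j → ¬ E Gem i j → bag i ∥ bag j → Related i j
    apart i j ¬h ap = (λ p q → proj₁ (ap p q) refl) , (λ h → contradiction h ¬h) , λ { (_ , p , _ , q , e) → contradiction e (proj₂ (ap p q)) }
    related : ∀ i j → i ≢ j → Related i j
    related 0F 0F i≢j = contradiction refl i≢j
    related 1F 1F i≢j = contradiction refl i≢j
    related 2F 2F i≢j = contradiction refl i≢j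
    related 3F 3F i≢j = contradiction refl i≢j
    related 4F 4F i≢j = contradiction refl i≢j
    related 0F 1F _ = touching 0F 1F tt a#b a⟷b
    related 1F 2F _ = touching 1F 2F tt b#c b⟷c
    related 2F 3F _ = touching 2F 3F tt c#d c⟷d
    related 4F 0F _ = touching 4F 0F tt hub#a hub⟷a
    related 4F 1F _ = touching 4F 1F tt hub#b hub⟷b
    related 4F 2F _ = touching 4F 2F tt hub#c hub⟷c
    related 4F 3F _ = touching 4F 3F tt hub#d hub⟷d
    related 0F 2F _ = apart 0F 2F (λ ()) a∥c
    related 0F 3F _ = apart 0F 3F (λ ()) a∥d
    related 1F 3F _ = apart 1F 3F (λ ()) b∥d
    related 1F 0F p = Related-sym 0F 1F (related 0F 1F (≢-sym p))
    related 2F 1F p = Related-sym 1F 2F (related 1F 2F (≢-sym p))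
    related 3F 2F p = Related-sym 2F 3F (related 2F 3F (≢-sym p))
    related 0F 4F p = Related-sym 4F 0F (related 4F 0F (≢-sym p))
    related 1F 4F p = Related-sym 4F 1F (related 4F 1F (≢-sym p))
    related 2F 4F p = Related-sym 4F 2F (related 4F 2F (≢-sym p))
    related 3F 4F p = Related-sym 4F 3F (related 4F 3F (≢-sym p))
    related 2F 0F p = Related-sym 0F 2F (related 0F 2F (≢-sym p))
    related 3F 0F p = Related-sym 0F 3F (related 0F 3F (≢-sym p))
    related 3F 1F p = Related-sym 1F 3F (related 1F 3F (≢-sym p))
    nonempty : ∀ i → ∃ λ v → v ∈ bag i
    nonempty 0F = let v , v∈ , _ = a⟷b in v , v∈
    nonempty 1F = let v , v∈ , _ = b⟷c in v , v∈
    nonempty 2F = let v , v∈ , _ = c⟷d in v , v∈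
    nonempty 3F = let v , v∈ , _ = ⟷-sym c⟷d in v , v∈
    nonempty 4F = let v , v∈ , _ = hub⟷a in v , v∈
    connected : ∀ i → Conn (bag i)
    connected 0F = conn-a
    connected 1F = conn-b
    connected 2F = conn-c
    connected 3F = conn-d
    connected 4F = conn-hub
    label : Fin n → Maybe (Fin 5)
    label v with any? (λ i → v ∈? bag i)
    ... | yes (i , _) = just i
    ... | no  _       = nothing
    label⁻ : ∀ {v i} → label v ≡ just i → v ∈ bag i
    label⁻ {v} p with any? (λ i → v ∈? bag i)
    label⁻ refl | yes (_ , v∈) = v∈
    label⁺ : ∀ {v i} → v ∈ bag i → label v ≡ just i
    label⁺ {v} {i} v∈ with any? (λ i → v ∈? bag i)
    ... | no none = contradiction (i , v∈) none
    ... | yes (j , v∈′) with i ≟ j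
    ...   | yes refl = refl
    ...   | no i≢j   = contradiction v∈′ (proj₁ (related i j i≢j) v∈)

  -- Menger’s theorem for two paths

  Meets : Subset n → (Fin n → Set) → Set
  Meets K A = ∃ λ a → a ∈ K × A a

  -- Stands for two disjoint paths from `A` to `B`: the paths are fattened to connected sets that
  -- partition `W`, ready to serve as branch sets.
  record Split (W : Subset n) (A B : Fin n → Set) : Set where
    field
      K₁ K₂ : Subset n
      conn₁ : Conn K₁
      conn₂ : Conn K₂
      disjoint : K₁ # K₂
      sub₁ : K₁ ⊆ W
      sub₂ : K₂ ⊆ W
      cover : ∀ {w} → w ∈ W → w ∈ K₁ ⊎ w ∈ K₂
      A₁ : Meets K₁ A
      A₂ : Meets K₂ A
      B₁ : Meets K₁ B
      B₂ : Meets K₂ B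

  Split-swap : ∀ {W A B} → Split W A B → Split W A B
  Split-swap s = record
    { K₁ = K₂ ; K₂ = K₁ ; conn₁ = conn₂ ; conn₂ = conn₁ ; disjoint = #-sym disjoint
    ; sub₁ = sub₂ ; sub₂ = sub₁ ; cover = λ w∈ → [ inj₂ , inj₁ ]′ (cover w∈)
    ; A₁ = A₂ ; A₂ = A₁ ; B₁ = B₂ ; B₂ = B₁ }
    where open Split s

  Separates : Subset n → (A B : Fin n → Set) → Fin n → Set
  Separates W A B c = ∀ {a b} → a ∈ W - c → A a → B b → ¬ Star (Step (W - c)) a b

  -- Pick `a` in `A`. If no component of `W - a` meets both `A` and `B`, then `a` separates.
  -- Otherwise let `C` be one that does. If the rest of `W`, connected through `a`, also meets `B`,
  -- these two sets are the split; if not, induction applies to `C`.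
  menger : ∀ {W A B} → (∀ v → Dec (A v)) → (∀ v → Dec (B v)) → Conn W → Meets W A →
    Split W A B ⊎ ∃ λ c → c ∈ W × Separates W A B c
  menger {W} A? B? cW A∩W = go W (⊂-wellFounded W) A? B? cW A∩W
    where
    go : ∀ W → Acc _⊂_ W → ∀ {A B} → (∀ v → Dec (A v)) → (∀ v → Dec (B v)) → Conn W → Meets W A →
      Split W A B ⊎ ∃ λ c → c ∈ W × Separates W A B c
    go W (acc rec) {A} {B} A? B? cW (a , a∈W , Aa)
      with any? (λ a′ → any? (λ b → A? a′ ×-dec B? b ×-dec reach? (W - a) a′ b))
    ... | no none = inj₂ (a , a∈W , λ a′∈ Aa′ Bb s → none (_ , _ , Aa′ , Bb , a′∈ , s))
    ... | yes (a′ , b , Aa′ , Bb , a′∈ , s)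
      with any? (λ q → q ∈? W ─ Component-of.C (component a′∈) ×-dec B? q)
    ...   | yes (q , q∈Q , Bq) = inj₁ (record
      { K₁ = C ; K₂ = W ─ C ; conn₁ = conn ; conn₂ = conn-─ cW a∈W sub closed
      ; disjoint = λ p q → x∉p─q q p ; sub₁ = λ p → p─q⊆p W _ (sub p) ; sub₂ = p─q⊆p W C
      ; cover = cover ; A₁ = a′ , root , Aa′ ; A₂ = a , a∈Q , Aa
      ; B₁ = b , reach⇒∈ (component a′∈) s , Bb ; B₂ = q , q∈Q , Bq })
      where
      open Component-of (component a′∈)
      a∈Q : a ∈ W ─ C
      a∈Q = x∈p∧x∉q⇒x∈p─q a∈W (x∉p-x ∘ sub)
      cover : ∀ {w} → w ∈ W → w ∈ C ⊎ w ∈ W ─ C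
      cover {w} w∈W with w ∈? C
      ... | yes w∈C = inj₁ w∈C
      ... | no  w∉C = inj₂ (x∈p∧x∉q⇒x∈p─q w∈W w∉C)
    -- Q is absorbed into A: inside C, the neighbours of Q join A.
    ...   | no B∌Q = [ inj₁ ∘ join , inj₂ ∘ separate ]′
      (go C (rec ((λ p → p─q⊆p W _ (sub p)) , a , a∈W , x∉p-x ∘ sub)) A′? B? conn (a′ , root , inj₁ Aa′))
      where
      open Component-of (component a′∈)
      Q = W ─ C
      C⊆W : C ⊆ W
      C⊆W p = p─q⊆p W _ (sub p)
      a∈Q : a ∈ Q
      a∈Q = x∈p∧x∉q⇒x∈p─q a∈W (x∉p-x ∘ sub)
      cQ : Conn Q
      cQ = conn-─ cW a∈W sub closed
      A′ : Fin n → Set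
      A′ v = A v ⊎ v ~ Q
      A′? : ∀ v → Dec (A′ v)
      A′? v = A? v ⊎-dec v ~? Q
      attach : (s : Split C A′ B) → Split.K₂ s ⟷ Q → Meets (Split.K₁ s) A → Split W A B
      attach s t m = record
        { K₁ = K₁ ; K₂ = K₂ ∪ Q ; conn₁ = conn₁ ; conn₂ = conn-∪ conn₂ cQ t
        ; disjoint = λ p → ∪-elim (disjoint p) (λ q → x∉p─q q (sub₁ p))
        ; sub₁ = C⊆W ∘ sub₁ ; sub₂ = ∪-elim (C⊆W ∘ sub₂) (p─q⊆p W C)
        ; cover = cov ; A₁ = m ; A₂ = a , ∪ʳ {p = K₂} a∈Q , Aa
        ; B₁ = B₁ ; B₂ = let b , b∈ , Bb = B₂ in b , ∪ˡ b∈ , Bb }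
        where
        open Split s
        cov : ∀ {w} → w ∈ W → w ∈ K₁ ⊎ w ∈ K₂ ∪ Q
        cov {w} w∈W with w ∈? C
        ... | yes w∈C = [ inj₁ , inj₂ ∘ ∪ˡ ]′ (cover w∈C)
        ... | no  w∉C = inj₂ (∪ʳ {p = K₂} (x∈p∧x∉q⇒x∈p─q w∈W w∉C))
      -- `Q` goes to a part that it touches, provided the other part meets the original `A`. If both
      -- parts come with a vertex of `A`, then `Q` touches one of them since `W` is connected; if
      -- both come with a neighbour of `Q`, then `a′` lies in one part and `Q` goes to the other.
      join : Split C A′ B → Split W A B
      join s with Split.A₁ s | Split.A₂ s
      ... | u , u∈ , inj₁ Au | v , v∈ , inj₂ v~ = attach s (~⇒⟷ v∈ v~) (u , u∈ , Au)
      ... | u , u∈ , inj₂ u~ | v , v∈ , inj₁ Av = attach (Split-swap s) (~⇒⟷ u∈ u~) (v , v∈ , Av)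
      ... | u , u∈ , inj₁ Au | v , v∈ , inj₁ Av
        with exit (_∈? C) (cW (C⊆W root) a∈W) root (x∉p-x ∘ sub)
      ...   | p , q , p∈C , q∉C , (_ , q∈W , e) with Split.cover s p∈C
      ...     | inj₁ p∈ = attach (Split-swap s) (~⇒⟷ p∈ (q , x∈p∧x∉q⇒x∈p─q q∈W q∉C , e)) (v , v∈ , Av)
      ...     | inj₂ p∈ = attach s (~⇒⟷ p∈ (q , x∈p∧x∉q⇒x∈p─q q∈W q∉C , e)) (u , u∈ , Au)
      join s | u , u∈ , inj₂ u~ | v , v∈ , inj₂ v~ with Split.cover s root
      ...   | inj₁ a′∈₁ = attach s (~⇒⟷ v∈ v~) (a′ , a′∈₁ , Aa′)
      ...   | inj₂ a′∈₂ = attach (Split-swap s) (~⇒⟷ u∈ u~) (a′ , a′∈₂ , Aa′)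
      separate : (∃ λ c → c ∈ C × Separates C A′ B c) → ∃ λ c → c ∈ W × Separates W A B c
      separate (c , c∈C , sep) = c , C⊆W c∈C , λ a∈ Aa Bb s →
        [ (λ { (a₁ , a₁∈ , A₁ , s′) → sep a₁∈ A₁ Bb s′ })
        , (λ { (w∈C , s′) → sep (x∈p∧x≢y⇒x∈p-y w∈C (λ { refl → x∉p-x a∈ })) (inj₁ Aa) Bb s′ }) ]′ (walk a∈ Bb s)
        where
        -- After its last visit to `Q` the walk stays in `C`, which it enters at a neighbour of `Q`,
        -- hence in `A′`. It cannot end in `Q`, which misses `B`.
        walk : ∀ {w b} → w ∈ W - c → B b → Star (Step (W - c)) w b →
          (∃ λ a₁ → a₁ ∈ C - c × A′ a₁ × Star (Step (C - c)) a₁ b) ⊎ (w ∈ C × Star (Step (C - c)) w b)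
        walk {w} w∈ Bw ε with w ∈? C
        ... | yes w∈C = inj₂ (w∈C , ε)
        ... | no  w∉C = contradiction (w , x∈p∧x∉q⇒x∈p─q (p─q⊆p W _ w∈) w∉C , Bw) B∌Q
        walk {w} w∈ Bb (_◅_ {j = w′} (p , q , e) s) with walk q Bb s
        ... | inj₁ r = inj₁ r
        ... | inj₂ (w′∈C , s′) with w ∈? C
        ...   | yes w∈C = inj₂ (w∈C , (keep p w∈C , keep q w′∈C , e) ◅ s′)
          where
          keep : ∀ {v} → v ∈ W - c → v ∈ C → v ∈ C - c
          keep v∈ v∈C = x∈p∧x≢y⇒x∈p-y v∈C (λ { refl → x∉p-x v∈ })
        ...   | no  w∉C = inj₁ (w′ , x∈p∧x≢y⇒x∈p-y w′∈C (λ { refl → x∉p-x q }) ,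
                                inj₂ (w , x∈p∧x∉q⇒x∈p─q (p─q⊆p W _ p) w∉C , Esym e) , s′)

  -- Cut pairs and their sides

  -- `conn` and `closed` make `W` a component of the graph without `x` and `z`. The pair is a
  -- parameter because it changes during the recursion.
  record Side (x z : Fin n) (W : Subset n) : Set where
    field
      conn : Conn W
      x≢z : x ≢ z
      x∉W : x ∉ W
      z∉W : z ∉ W
      x~W : x ~ W
      z~W : z ~ W
      closed : ∀ {u w} → u ∈ W → E G u w → w ∈ W ⊎ w ≡ x ⊎ w ≡ z

  Side-swap : ∀ {x z W} → Side x z W → Side z x W
  Side-swap s = record
    { conn = conn ; x≢z = ≢-sym x≢z ; x∉W = z∉W ; z∉W = x∉W ; x~W = z~W ; z~W = x~W
    ; closed = λ p e → [ inj₁ , [ inj₂ ∘ inj₂ , inj₂ ∘ inj₁ ]′ ]′ (closed p e) }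
    where open Side s

  Side-∥ : ∀ {x z W O} → Side x z W → x ∉ O → z ∉ O → W # O → W ∥ O
  Side-∥ s x∉O z∉O W#O p q = (λ { refl → W#O p q }) , λ e →
    [ (λ w → W#O w q) , [ (λ { refl → x∉O q }) , (λ { refl → z∉O q }) ]′ ]′ (Side.closed s p e)

  Double : Fin n → Fin n → Subset n → Set
  Double x z W = Split W (λ v → E G v x) (λ v → E G v z)

  Double-swap : ∀ {x z W} → Double x z W → Double z x W
  Double-swap s = record
    { K₁ = K₁ ; K₂ = K₂ ; conn₁ = conn₁ ; conn₂ = conn₂ ; disjoint = disjoint
    ; sub₁ = sub₁ ; sub₂ = sub₂ ; cover = cover ; A₁ = B₁ ; A₂ = B₂ ; B₁ = A₁ ; B₂ = A₂ }
    where open Split s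

  -- Chains of vertices of degree two

  head′ : Fin n → List (Fin n) → Fin n
  head′ z []      = z
  head′ z (u ∷ _) = u

  last′ : Fin n → List (Fin n) → Fin n
  last′ x []      = x
  last′ x (u ∷ l) = last′ u l

  head′-++ : ∀ {z c} l {l′} → head′ z (l ++ c ∷ l′) ≡ head′ c l
  head′-++ []      = refl
  head′-++ (_ ∷ _) = refl

  last′-++ : ∀ {x c} l {l′} → last′ x (l ++ c ∷ l′) ≡ last′ c l′
  last′-++ []      = refl
  last′-++ (_ ∷ l) = last′-++ l

  head′-∈ : ∀ {z} l → head′ z l ∈ˡ l ⊎ head′ z l ≡ z
  head′-∈ []      = inj₂ refl
  head′-∈ (_ ∷ _) = inj₁ (hereˡ refl)

  last′-∈ : ∀ {x} l → last′ x l ∈ˡ l ⊎ last′ x l ≡ x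
  last′-∈ []      = inj₂ refl
  last′-∈ (u ∷ l) with last′-∈ {u} l
  ... | inj₁ p = inj₁ (thereˡ p)
  ... | inj₂ p = inj₁ (hereˡ p)

  record Link (a u b : Fin n) : Set where
    constructor link
    field
      a≢b  : a ≢ b
      ua   : E G u a
      ub   : E G u b
      only : ∀ {w} → E G u w → w ≡ a ⊎ w ≡ b

  -- Only the vertices of the list are forced to have degree two; the ends may have further
  -- neighbours. The default of `head′` is the far end, so the last vertex of the list is linked to
  -- `z`.
  data Chain : Fin n → List (Fin n) → Fin n → Set where
    []  : ∀ {a z} → Chain a [] z
    _∷_ : ∀ {a u l z} → Link a u (head′ z l) → Chain u l z → Chain a (u ∷ l) z

  Chain-++ : ∀ {x l c l′ z} → Chain x l c → Link (last′ x l) c (head′ z l′) → Chain c l′ z →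
    Chain x (l ++ c ∷ l′) z
  Chain-++ [] k ch′ = k ∷ ch′
  Chain-++ {l = u ∷ l} (k₀ ∷ ch) k ch′ = subst (Link _ u) (sym (head′-++ l)) k₀ ∷ Chain-++ ch k ch′

  -- `only-x` and `only-z` carry the gluing: when an end is the cut vertex of a larger side, they
  -- leave it a single neighbour inside this piece.
  record PathSide (x z : Fin n) (W : Subset n) : Set where
    field
      l : List (Fin n)
      ∈⇒ : ∀ {w} → w ∈ W → w ∈ˡ l
      ∈⇐ : ∀ {w} → w ∈ˡ l → w ∈ W
      unique : Unique l
      chain : Chain x l z
      xE : E G x (head′ z l)
      zE : E G z (last′ x l)
      only-x : ∀ {u} → u ∈ W → E G u x → u ≡ head′ z l
      only-z : ∀ {u} → u ∈ W → E G u z → u ≡ last′ x l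

  -- Unlike a PathSide, an Arm may have an empty interior D, namely when the ends are adjacent.
  record Arm (p q : Fin n) (D : Fin n → Set) : Set where
    field
      l : List (Fin n)
      ∈⇒ : ∀ {w} → D w → w ∈ˡ l
      ∈⇐ : ∀ {w} → w ∈ˡ l → D w
      unique : Unique l
      chain : Chain p l q
      pE : E G p (head′ q l)
      qE : E G q (last′ p l)
      only-p : ∀ {u} → D u ⊎ u ≡ q → E G u p → u ≡ head′ q l
      only-q : ∀ {u} → D u ⊎ u ≡ p → E G u q → u ≡ last′ p l

  Arm-[] : ∀ {p q} → E G p q → Arm p q (λ _ → ⊥)
  Arm-[] e = record
    { l = [] ; ∈⇒ = λ () ; ∈⇐ = λ () ; unique = [] ; chain = [] ; pE = e ; qE = Esym e
    ; only-p = λ { (inj₂ p) _ → p } ; only-q = λ { (inj₂ p) _ → p } }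

  PathSide⇒Arm : ∀ {p q D} → PathSide p q D → ¬ E G p q → Arm p q (_∈ D)
  PathSide⇒Arm s ¬pq = record
    { l = l ; ∈⇒ = ∈⇒ ; ∈⇐ = ∈⇐ ; unique = unique ; chain = chain ; pE = xE ; qE = zE
    ; only-p = λ { (inj₁ u∈) e → only-x u∈ e ; (inj₂ refl) e → contradiction (Esym e) ¬pq }
    ; only-q = λ { (inj₁ u∈) e → only-z u∈ e ; (inj₂ refl) e → contradiction e ¬pq } }
    where open PathSide s

  -- The neighbours of `c` lie in the two arms or among `x` and `z`, and each arm, its outer end
  -- included, contains just one of them; so `c` has degree two and joins the chains.
  concat-arms : ∀ {x c z W D₁ D₂} → Side x z W → c ∈ W →
    (∀ {w} → w ∈ W → D₁ w ⊎ w ≡ c ⊎ D₂ w) →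
    (∀ {w} → D₁ w → w ∈ W - c × ¬ D₂ w × ¬ E G w z) →
    (∀ {w} → D₂ w → w ∈ W - c × ¬ E G w x) →
    Arm x c D₁ → Arm c z D₂ → PathSide x z W
  concat-arms {x} {c} {z} {W} {D₁} {D₂} side c∈W cover in₁ in₂ A₁ A₂ = record
    { l = A.l ++ c ∷ B.l
    ; ∈⇒ = λ w∈ → [ ∈-++⁺ˡ ∘ A.∈⇒ , [ (λ { refl → ∈-++⁺ʳ A.l (hereˡ refl) }) , ∈-++⁺ʳ A.l ∘ thereˡ ∘ B.∈⇒ ]′ ]′ (cover w∈)
    ; ∈⇐ = λ w∈ → [ D₁⊆W ∘ A.∈⇐ , (λ { (hereˡ refl) → c∈W ; (thereˡ p) → D₂⊆W (B.∈⇐ p) }) ]′ (∈-++⁻ A.l w∈)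
    ; unique = ++⁺ A.unique (All.tabulate (λ { p refl → x∉p-x (proj₁ (in₂ (B.∈⇐ p))) }) ∷ B.unique)
        λ { (p , hereˡ refl) → x∉p-x (proj₁ (in₁ (A.∈⇐ p)))
          ; (p , thereˡ q) → proj₁ (proj₂ (in₁ (A.∈⇐ p))) (B.∈⇐ q) }
    ; chain = Chain-++ A.chain (link ends-≢ A.qE B.pE only-c) B.chain
    ; xE = subst (E G x) (sym (head′-++ A.l)) A.pE
    ; zE = subst (E G z) (sym (last′-++ A.l)) B.qE
    ; only-x = λ u∈ e → trans ([ (λ d → A.only-p (inj₁ d) e) , [ (λ p → A.only-p (inj₂ p) e) , (λ d → contradiction e (proj₂ (in₂ d))) ]′ ]′ (cover u∈)) (sym (head′-++ A.l))
    ; only-z = λ u∈ e → trans ([ (λ d → contradiction e (proj₂ (proj₂ (in₁ d)))) , [ (λ p → B.only-q (inj₂ p) e) , (λ d → B.only-q (inj₁ d) e) ]′ ]′ (cover u∈)) (sym (last′-++ A.l))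
    }
    where
    module A = Arm A₁
    module B = Arm A₂
    open Side side
    D₁⊆W : ∀ {w} → D₁ w → w ∈ W
    D₁⊆W d = p─q⊆p W _ (proj₁ (in₁ d))
    D₂⊆W : ∀ {w} → D₂ w → w ∈ W
    D₂⊆W d = p─q⊆p W _ (proj₁ (in₂ d))
    ends-≢ : last′ x A.l ≢ head′ z B.l
    ends-≢ eq with last′-∈ {x} A.l | head′-∈ {z} B.l
    ... | inj₁ p | inj₁ q = proj₁ (proj₂ (in₁ (A.∈⇐ p))) (B.∈⇐ (subst (_∈ˡ B.l) (sym eq) q))
    ... | inj₁ p | inj₂ q = z∉W (D₁⊆W (A.∈⇐ (subst (_∈ˡ A.l) (trans eq q) p)))
    ... | inj₂ p | inj₁ q = x∉W (D₂⊆W (B.∈⇐ (subst (_∈ˡ B.l) (trans (sym eq) p) q)))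
    ... | inj₂ p | inj₂ q = x≢z (trans (sym p) (trans eq q))
    only-c : ∀ {w} → E G c w → w ≡ last′ x A.l ⊎ w ≡ head′ z B.l
    only-c e with closed c∈W e
    ... | inj₂ (inj₁ p) = inj₁ (A.only-q (inj₂ p) (Esym e))
    ... | inj₂ (inj₂ p) = inj₂ (B.only-p (inj₂ p) (Esym e))
    ... | inj₁ w∈W with cover w∈W
    ...   | inj₁ d = inj₁ (A.only-q (inj₁ d) (Esym e))
    ...   | inj₂ (inj₁ refl) = contradiction e (E-irrefl simple)
    ...   | inj₂ (inj₂ d) = inj₂ (B.only-p (inj₁ d) (Esym e))

  -- Path sides as induced paths

  Link⇒degree2 : ∀ {a u b} → Link a u b → degree G u ≡ 2
  Link⇒degree2 {a} {u} {b} (link a≢b ua ub only) = card-2 (G u) a b a≢b ua ub only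

  Chain⇒degree2 : ∀ {a l z} → Chain a l z → ∀ i → degree G (lookup l i) ≡ 2
  Chain⇒degree2 (k ∷ _)  zero    = Link⇒degree2 k
  Chain⇒degree2 (_ ∷ ch) (suc i) = Chain⇒degree2 ch i

  Consecutive : ℕ → ℕ → Set
  Consecutive i j = i ≡ suc j ⊎ j ≡ suc i

  Link⇒adjacency : ∀ {a u z} l → Link a u (head′ z l) → Unique (u ∷ l) → a ∉ˡ u ∷ l →
    ∀ j → E G u (lookup l j) ⇔ Consecutive 0 (suc (toℕ j))
  Link⇒adjacency (v ∷ l) k _ _ zero = mk⇔ (λ _ → inj₂ refl) (λ _ → Link.ub k)
  Link⇒adjacency {u = u} (v ∷ l) k (_ ∷ v∉ ∷ _) a∉ (suc j) = mk⇔
    (λ e → [ (λ p → contradiction (subst (_∈ˡ u ∷ v ∷ l) p (∈-lookup {xs = u ∷ v ∷ l} (suc (suc j)))) a∉)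
           , (λ p → contradiction (sym p) (All.lookup v∉ (∈-lookup {xs = l} j))) ]′ (Link.only k e))
    λ { (inj₁ ()) ; (inj₂ ()) }

  -- Induction along the chain: the first vertex has only its two linked neighbours, of which the
  -- preceding one lies outside the list. In the recursive call the first vertex becomes the
  -- preceding one, outside the tail by uniqueness.
  Chain⇒adjacency : ∀ {a l z} → Chain a l z → Unique l → a ∉ˡ l → z ∉ˡ l →
    ∀ i j → E G (lookup l i) (lookup l j) ⇔ Consecutive (toℕ i) (toℕ j)
  Chain⇒adjacency (_ ∷ _) _ _ _ zero zero = mk⇔ (⊥-elim ∘ E-irrefl simple) λ { (inj₁ ()) ; (inj₂ ()) }
  Chain⇒adjacency (_∷_ {u = u} k ch) (u∉ ∷ un) a∉ z∉ (suc i) (suc j) =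
    mk⇔ ([ inj₁ ∘ cong suc , inj₂ ∘ cong suc ]′ ∘ Equivalence.to ih)
        (Equivalence.from ih ∘ [ inj₁ ∘ ℕ.suc-injective , inj₂ ∘ ℕ.suc-injective ]′)
    where ih = Chain⇒adjacency ch un (λ u∈ → All.lookup u∉ u∈ refl) (z∉ ∘ thereˡ) i j
  Chain⇒adjacency {l = _ ∷ l} (k ∷ _) un a∉ z∉ zero (suc j) = Link⇒adjacency l k un a∉ j
  Chain⇒adjacency {l = _ ∷ l} (k ∷ _) un a∉ z∉ (suc i) zero = mk⇔
    ([ inj₂ , inj₁ ]′ ∘ Equivalence.to flipped ∘ Esym)
    (Esym ∘ Equivalence.from flipped ∘ [ inj₂ , inj₁ ]′)
    where flipped = Link⇒adjacency l k un a∉ i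

  PathSide⇒path : ∀ {x z W} {S : Fin n → Set} → Side x z W → PathSide x z W → (∀ w → S w ⇔ w ∈ W) → IsPathDeg2On G S
  PathSide⇒path {S = S} side path S⇔W = length l , lookup l , lookup-injective unique , members ,
    Chain⇒adjacency chain unique (Side.x∉W side ∘ ∈⇐) (Side.z∉W side ∘ ∈⇐) , λ i _ _ → Chain⇒degree2 chain i
    where
    open PathSide path
    members : ∀ w → S w ⇔ ∃ λ i → lookup l i ≡ w
    members w = mk⇔
      (λ s → let w∈ = ∈⇒ (Equivalence.to (S⇔W w) s) in Any.index w∈ , sym (lookup-index w∈))
      λ { (i , refl) → Equivalence.from (S⇔W _) (∈⇐ (∈-lookup {xs = l} i)) }

-- Recursion on sides of cut pairs

module TwoConnectedGraph {n} (G : Adj n) (simple : IsSimple G) (two : TwoConnected G) where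
  open Graph G simple

  bypass : ∀ {v x y} → x ≢ v → y ≢ v → Star (λ a b → a ≢ v × b ≢ v × E G a b) x y
  bypass {v} {x} {y} = proj₂ (proj₂ two) v x y

  _separates_from_in′_ : Fin n → Fin n → Fin n → Subset n → Set
  c separates x from z in′ W = Separates W (λ v → E G v x) (λ v → E G v z) c

  -- Sides in a hereditary class Φ that are never double (or else R holds) are paths: Menger gives
  -- a vertex c cutting x from z inside W, and the parts of W - c are smaller sides.
  module _ (Φ : Fin n → Fin n → Subset n → Set) (R : Set)
    (φ-side : ∀ {x z W} → Φ x z W → Side x z W)
    (φ-swap : ∀ {x z W} → Φ x z W → Φ z x W)
    (φ-double : ∀ {x z W} → Φ x z W → Double x z W → R)
    (φ-sub : ∀ {x z W c D} → Φ x z W → c ∈ W → c separates x from z in′ W → Side x c D → D ⊆ W - c → z ≁ D →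
             (∀ {u} → u ∈ W → E G x u → u ∈ D) × Φ x c D)
    where

    data Part (x z c : Fin n) (W : Subset n) : Set where
      adjacent : E G x c → x ≁ W - c → Part x z c W
      proper   : ∀ D → Side x c D → D ⊆ W - c → z ≁ D → (∀ {u} → u ∈ W → E G x u → u ∈ D) → Φ x c D → Part x z c W

    -- The piece is the component of `W - c` at a neighbour of `x`. It touches `c` since `W` is
    -- connected and misses `z` since `c` separates, so it is a side of `x` and `c`.
    part : ∀ {x z c W} → Φ x z W → c ∈ W → c separates x from z in′ W → Part x z c W
    part {x} {z} {c} {W} φ c∈W sep with x ~? (W - c)
    ... | no x≁ = adjacent xc x≁
      where
      open Side (φ-side φ)
      xc : E G x c
      xc with x~W
      ... | u , u∈W , e with u ≟ c
      ...   | yes refl = e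
      ...   | no u≢c = contradiction (u , x∈p∧x≢y⇒x∈p-y u∈W u≢c , e) x≁
    ... | yes (t , t∈ , xt) = proper C side sub z≁C (proj₁ below) (proj₂ below)
      where
      open Side (φ-side φ) renaming (conn to cW; closed to closedW)
      open Component-of (component t∈)
      C⊆W : C ⊆ W
      C⊆W p = p─q⊆p W _ (sub p)
      c∉C : c ∉ C
      c∉C p = x∉p-x (sub p)
      z≁C : z ≁ C
      z≁C (b , b∈ , zb) = sep t∈ (Esym xt) (Esym zb) (∈⇒reach (component t∈) b∈)
      c~C : c ~ C
      c~C with exit (_∈? C) (cW (C⊆W root) c∈W) root c∉C
      ... | p , q , p∈C , q∉C , (_ , q∈W , e) with q ≟ c
      ...   | yes refl = p , p∈C , Esym e
      ...   | no q≢c = contradiction (closed p∈C (x∈p∧x≢y⇒x∈p-y q∈W q≢c) e) q∉C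
      side : Side x c C
      side = record
        { conn = conn ; x≢z = λ { refl → x∉W c∈W } ; x∉W = x∉W ∘ C⊆W ; z∉W = c∉C
        ; x~W = t , root , xt ; z~W = c~C ; closed = close }
        where
        close : ∀ {u w} → u ∈ C → E G u w → w ∈ C ⊎ w ≡ x ⊎ w ≡ c
        close {u} {w} u∈C e with closedW (C⊆W u∈C) e | w ≟ c
        ... | _               | yes w≡c = inj₂ (inj₂ w≡c)
        ... | inj₁ w∈W        | no w≢c  = inj₁ (closed u∈C (x∈p∧x≢y⇒x∈p-y w∈W w≢c) e)
        ... | inj₂ (inj₁ w≡x) | no _    = inj₂ (inj₁ w≡x)
        ... | inj₂ (inj₂ refl) | no _   = contradiction (u , u∈C , Esym e) z≁C
      below = φ-sub φ c∈W sep side sub z≁C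

    Interior : ∀ {x z c W} → Part x z c W → Fin n → Set
    Interior (adjacent _ _) _ = ⊥
    Interior (proper D _ _ _ _ _) v = v ∈ D

    Interior-sub : ∀ {x z c W} (p : Part x z c W) {v} → Interior p v → v ∈ W - c × ¬ E G v z
    Interior-sub (proper D _ sub z≁D _ _) d = sub d , λ e → z≁D (_ , d , Esym e)

    Interior-near : ∀ {x z c W} (p : Part x z c W) {v} → v ∈ W - c → E G x v → Interior p v
    Interior-near (adjacent _ x≁) v∈ e = contradiction (_ , v∈ , e) x≁
    Interior-near {W = W} (proper _ _ _ _ uniq _) v∈ e = uniq (p─q⊆p W _ v∈) e

    Interior-closed : ∀ {x z c W} (p : Part x z c W) → x ∉ W → ∀ {u v} → Interior p u → v ∈ W - c → E G u v → Interior p v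
    Interior-closed {W = W} (proper _ s _ _ _ _) x∉W d v∈ e with Side.closed s d e
    ... | inj₁ v∈D = v∈D
    ... | inj₂ (inj₁ refl) = contradiction (p─q⊆p W _ v∈) x∉W
    ... | inj₂ (inj₂ refl) = contradiction v∈ x∉p-x

    Interior-reach : ∀ {x z c W} (p : Part x z c W) → x ∉ W → ∀ {u v} → Interior p u → Star (Step (W - c)) u v → Interior p v
    Interior-reach p x∉W d ε = d
    Interior-reach p x∉W d ((_ , v∈ , e) ◅ s) = Interior-reach p x∉W (Interior-closed p x∉W d v∈ e) s

    thin⇒path : ∀ {x z W} → Φ x z W → R ⊎ PathSide x z W
    thin⇒path {W = W} = go (⊂-wellFounded W)
      where
      go : ∀ {x z W} → Acc _⊂_ W → Φ x z W → R ⊎ PathSide x z W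
      go {x} {z} {W} (acc rec) φ
        with menger (λ v → E? v x) (λ v → E? v z) (Side.conn (φ-side φ)) (let u , u∈ , e = Side.x~W (φ-side φ) in u , u∈ , Esym e)
      ... | inj₁ s = inj₁ (φ-double φ s)
      ... | inj₂ (c , c∈W , sep) = assemble (armˡ left) (armʳ right)
        where
        open Side (φ-side φ)
        left : Part x z c W
        left = part φ c∈W sep
        right : Part z x c W
        right = part (φ-swap φ) c∈W (λ {a} {b} a∈ az bx s → sep (end∈ a∈ s) bx az (reach-sym s))
          where
          end∈ : ∀ {S a b} → a ∈ S → Star (Step S) a b → b ∈ S
          end∈ a∈ ε = a∈
          end∈ a∈ ((_ , q , _) ◅ s) = end∈ q s
        smaller : ∀ {D} → D ⊆ W - c → D ⊂ W
        smaller sub = (λ d → p─q⊆p W _ (sub d)) , c , c∈W , x∉p-x ∘ sub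
        armˡ : (p : Part x z c W) → R ⊎ Arm x c (Interior p)
        armˡ (adjacent e _) = inj₂ (Arm-[] e)
        -- `PathSide⇒Arm` wants `x` and `c` nonadjacent: all neighbours of `x` in `W` lie in `D`,
        -- and `c` does not.
        armˡ (proper D s sub z≁D uniq φ′) = [ inj₁ , (λ p → inj₂ (PathSide⇒Arm p (λ e → Side.z∉W s (uniq c∈W e)))) ]′ (go (rec (smaller sub)) φ′)
        armʳ : (p : Part z x c W) → R ⊎ Arm c z (Interior p)
        armʳ (adjacent e _) = inj₂ (Arm-[] (Esym e))
        armʳ (proper D s sub x≁D uniq φ′) = [ inj₁ , (λ p → inj₂ (PathSide⇒Arm p (λ e → Side.z∉W s (uniq c∈W (Esym e))))) ]′ (go (rec (smaller sub)) (φ-swap φ′))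
        -- By 2-connectedness the component of `w` in `W - c` has an edge to `x` or to `z`, so `w`
        -- lies in the interior at that end.
        cover : ∀ {w} → w ∈ W → Interior left w ⊎ w ≡ c ⊎ Interior right w
        cover {w} w∈W with w ≟ c
        ... | yes w≡c = inj₂ (inj₁ w≡c)
        ... | no w≢c with component (x∈p∧x≢y⇒x∈p-y w∈W w≢c)
        ...   | comp with exit (_∈? Component-of.C comp) (bypass w≢c x≢c) (Component-of.root comp) (x∉W ∘ p─q⊆p W _ ∘ Component-of.sub comp)
          where
          x≢c : x ≢ c
          x≢c refl = x∉W c∈W
        ...     | p , q , p∈C , q∉C , (_ , q≢c , pq) with closed (p─q⊆p W _ (Component-of.sub comp p∈C)) pq
        ...       | inj₁ q∈W = contradiction (Component-of.closed comp p∈C (x∈p∧x≢y⇒x∈p-y q∈W q≢c) pq) q∉C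
        ...       | inj₂ (inj₁ refl) = inj₁ (Interior-reach left x∉W (Interior-near left (Component-of.sub comp p∈C) (Esym pq)) (reach-sym (∈⇒reach comp p∈C)))
        ...       | inj₂ (inj₂ refl) = inj₂ (inj₂ (Interior-reach right z∉W (Interior-near right (Component-of.sub comp p∈C) (Esym pq)) (reach-sym (∈⇒reach comp p∈C))))
        -- A common vertex would be connected inside `D` to a neighbour of `x`, which would then
        -- belong to the interior at `z`, where nothing is adjacent to `x`.
        apart : (p : Part x z c W) (q : Part z x c W) → ∀ {w} → Interior p w → ¬ Interior q w
        apart (proper D s sub z≁D _ _) q d i with Side.x~W s
        ... | t , t∈ , xt = proj₂ (Interior-sub q (Interior-reach q z∉W i (reach-mono sub (Side.conn s d t∈)))) (Esym xt)
        assemble : R ⊎ Arm x c (Interior left) → R ⊎ Arm c z (Interior right) → R ⊎ PathSide x z W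
        assemble (inj₁ r) _ = inj₁ r
        assemble (inj₂ _) (inj₁ r) = inj₁ r
        assemble (inj₂ A₁) (inj₂ A₂) = inj₂ (concat-arms (φ-side φ) c∈W cover
          (λ d → proj₁ (Interior-sub left d) , apart left right d , proj₂ (Interior-sub left d))
          (λ d → Interior-sub right d) A₁ A₂)

-- Double sides in gem-free graphs

module GemFreeGraph {n} (G : Adj n) (simple : IsSimple G) (gemFree : ¬ (Gem ≼ G)) (two : TwoConnected G) where
  open Graph G simple
  open TwoConnectedGraph G simple two

  noGem : ¬ GemBags
  noGem = gemFree ∘ GemBags⇒≼

  edge⟷ : ∀ {x y} → E G x y → ⁅ x ⁆ ⟷ ⁅ y ⁆
  edge⟷ {x} {y} e = x , x∈⁅x⁆ x , y , x∈⁅x⁆ y , e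

  ~⇒⁅⁆⟷ : ∀ {x U} → x ~ U → ⁅ x ⁆ ⟷ U
  ~⇒⁅⁆⟷ {x} t = x , x∈⁅x⁆ x , t

  ~⇒⟷⁅⁆ : ∀ {x U} → x ~ U → U ⟷ ⁅ x ⁆
  ~⇒⟷⁅⁆ t = ⟷-sym (~⇒⁅⁆⟷ t)

  dominated⇒noP4 : ∀ {S : Fin n → Set} {h} → (∀ {v} → S v → E G v h) → ¬ InducedP4In G S
  dominated⇒noP4 {h = h} dom (a , b , c , d , Sa , Sb , Sc , Sd , ab , bc , cd , ¬ac , ¬bd , ¬ad) = noGem record
    { hub = ⁅ h ⁆ ; a = ⁅ a ⁆ ; b = ⁅ b ⁆ ; c = ⁅ c ⁆ ; d = ⁅ d ⁆
    ; conn-hub = conn-⁅⁆ ; conn-a = conn-⁅⁆ ; conn-b = conn-⁅⁆ ; conn-c = conn-⁅⁆ ; conn-d = conn-⁅⁆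
    ; hub⟷a = spoke Sa ; hub⟷b = spoke Sb ; hub⟷c = spoke Sc ; hub⟷d = spoke Sd
    ; a⟷b = edge⟷ ab ; b⟷c = edge⟷ bc ; c⟷d = edge⟷ cd
    ; hub#a = off Sa ; hub#b = off Sb ; hub#c = off Sc ; hub#d = off Sd
    ; a#b = ⁅⁆-#-⁅⁆ (edge⇒≢ ab) ; b#c = ⁅⁆-#-⁅⁆ (edge⇒≢ bc) ; c#d = ⁅⁆-#-⁅⁆ (edge⇒≢ cd)
    -- Distinctness is not listed in `InducedP4In`; it follows because identifying two of the
    -- vertices would turn a path edge into a missing edge.
    ; a∥c = apart (λ { refl → ¬ad cd }) ¬ac
    ; a∥d = apart (λ { refl → ¬ac (Esym cd) }) ¬ad
    ; b∥d = apart (λ { refl → ¬ad ab }) ¬bd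
    }
    where
    spoke : ∀ {v} → _ → ⁅ h ⁆ ⟷ ⁅ v ⁆
    spoke Sv = edge⟷ (Esym (dom Sv))
    off : ∀ {v} → _ → ⁅ h ⁆ # ⁅ v ⁆
    off Sv = ⁅⁆-#-⁅⁆ (edge⇒≢ (Esym (dom Sv)))
    apart : ∀ {u v} → u ≢ v → ¬ E G u v → ⁅ u ⁆ ∥ ⁅ v ⁆
    apart u≢v ¬e p q with ⁅⁆-elim p | ⁅⁆-elim q
    ... | refl | refl = u≢v , ¬e

  -- Three connections between `x` and `z`. `W` may have edges to `K₂` but not to `K₁`, because `K₂`
  -- always joins the hub of a gem while `W` is an end of its path.
  record Theta (x z : Fin n) (K₁ K₂ W : Subset n) : Set where
    field
      conn₁ : Conn K₁
      conn₂ : Conn K₂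
      connW : Conn W
      x≢z : x ≢ z
      x∉K₁ : x ∉ K₁
      x∉K₂ : x ∉ K₂
      x∉W  : x ∉ W
      z∉K₁ : z ∉ K₁
      z∉K₂ : z ∉ K₂
      z∉W  : z ∉ W
      x~K₁ : x ~ K₁
      x~K₂ : x ~ K₂
      x~W  : x ~ W
      z~K₁ : z ~ K₁
      z~K₂ : z ~ K₂
      z~W  : z ~ W
      K₁⟷K₂ : K₁ ⟷ K₂
      K₁#K₂ : K₁ # K₂
      W∥K₁ : W ∥ K₁
      W#K₂ : W # K₂

  Theta-swap : ∀ {x z K₁ K₂ W} → Theta x z K₁ K₂ W → Theta z x K₁ K₂ W
  Theta-swap t = record
    { conn₁ = conn₁ ; conn₂ = conn₂ ; connW = connW ; x≢z = ≢-sym x≢z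
    ; x∉K₁ = z∉K₁ ; x∉K₂ = z∉K₂ ; x∉W = z∉W ; z∉K₁ = x∉K₁ ; z∉K₂ = x∉K₂ ; z∉W = x∉W
    ; x~K₁ = z~K₁ ; x~K₂ = z~K₂ ; x~W = z~W ; z~K₁ = x~K₁ ; z~K₂ = x~K₂ ; z~W = x~W
    ; K₁⟷K₂ = K₁⟷K₂ ; K₁#K₂ = K₁#K₂ ; W∥K₁ = W∥K₁ ; W#K₂ = W#K₂ }
    where open Theta t

  -- Suppose `v` misses `z`, and let `C` be the component of `K₁ - v` at a neighbour of `z`. If `C`
  -- sees `x` or `K₂`, the hub `x` with `K₂` and the path `W`, `z`, `C`, `v` form a gem. Otherwise
  -- the hub `z` with `K₂` and the path `W`, `x`, `K₁ ─ C`, `C` do.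
  theta : ∀ {x z K₁ K₂ W v} → Theta x z K₁ K₂ W → v ∈ K₁ → E G v x ⊎ v ~ K₂ → E G v z
  theta {x} {z} {K₁} {K₂} {W} {v} t v∈K₁ v~ with E? v z | Theta.z~K₁ t
  ... | yes e | _ = e
  ... | no ¬e | t₀ , t₀∈K₁ , zt₀ = ⊥-elim (byCases (x ~? C ⊎-dec C ⟷? K₂))
    where
    open Theta t
    t₀∈ : t₀ ∈ K₁ - v
    t₀∈ = x∈p∧x≢y⇒x∈p-y t₀∈K₁ (λ { refl → ¬e (Esym zt₀) })
    open Component-of (component t₀∈)
    C⊆K₁ : C ⊆ K₁
    C⊆K₁ p = p─q⊆p K₁ _ (sub p)
    v∉C : v ∉ C
    v∉C p = x∉p-x (sub p)
    C⟷v : C ⟷ ⁅ v ⁆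
    C⟷v with exit (_∈? C) (conn₁ t₀∈K₁ v∈K₁) root v∉C
    ... | p , q , p∈C , q∉C , (_ , q∈K₁ , e) with q ≟ v
    ...   | yes refl = p , p∈C , v , x∈⁅x⁆ v , e
    ...   | no q≢v = contradiction (closed p∈C (x∈p∧x≢y⇒x∈p-y q∈K₁ q≢v) e) q∉C
    z~C : z ~ C
    z~C = t₀ , root , zt₀
    sub⁅⁆ : ∀ {a U} → a ∈ U → ⁅ a ⁆ ⊆ U
    sub⁅⁆ {U = U} a∈U p = subst (_∈ U) (sym (⁅⁆-elim p)) a∈U
    byCases : Dec (x ~ C ⊎ C ⟷ K₂) → ⊥
    byCases (yes C~) = noGem record
      { hub = ⁅ x ⁆ ∪ K₂ ; a = W ; b = ⁅ z ⁆ ; c = C ; d = ⁅ v ⁆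
      ; conn-hub = conn-∪ conn-⁅⁆ conn₂ (~⇒⁅⁆⟷ x~K₂) ; conn-a = connW ; conn-b = conn-⁅⁆ ; conn-c = conn ; conn-d = conn-⁅⁆
      ; hub⟷a = ⟷-mono ∪ˡ id (~⇒⁅⁆⟷ x~W)
      ; hub⟷b = ⟷-mono (∪ʳ {p = ⁅ x ⁆}) id (~⇒⟷⁅⁆ z~K₂)
      ; hub⟷c = [ ⟷-mono ∪ˡ id ∘ ~⇒⁅⁆⟷ , ⟷-mono (∪ʳ {p = ⁅ x ⁆}) id ∘ ⟷-sym ]′ C~
      ; hub⟷d = [ ⟷-mono ∪ˡ id ∘ edge⟷ ∘ Esym , ⟷-mono (∪ʳ {p = ⁅ x ⁆}) id ∘ ~⇒⟷⁅⁆ ]′ v~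
      ; a⟷b = ~⇒⟷⁅⁆ z~W ; b⟷c = ~⇒⁅⁆⟷ z~C ; c⟷d = C⟷v
      ; hub#a = #-∪ˡ (⁅⁆-# x∉W) (#-sym W#K₂)
      ; hub#b = #-∪ˡ (⁅⁆-#-⁅⁆ x≢z) (#-sym (⁅⁆-# z∉K₂))
      ; hub#c = #-⊆ id C⊆K₁ x∪K₂#K₁
      ; hub#d = #-⊆ id (sub⁅⁆ v∈K₁) x∪K₂#K₁
      ; a#b = #-sym (⁅⁆-# z∉W) ; b#c = ⁅⁆-# (z∉K₁ ∘ C⊆K₁) ; c#d = #-sym (⁅⁆-# v∉C)
      ; a∥c = ∥-⊆ id C⊆K₁ W∥K₁
      ; a∥d = ∥-⊆ id (sub⁅⁆ v∈K₁) W∥K₁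
      ; b∥d = ∥-intro (⁅⁆-# (λ p → z∉K₁ (subst (_∈ K₁) (sym (⁅⁆-elim p)) v∈K₁)))
                      (λ { t → let w , w∈ , e = ⟷⇒~ t in ¬e (Esym (subst (E G z) (⁅⁆-elim w∈) e)) })
      }
      where
      x∪K₂#K₁ : ⁅ x ⁆ ∪ K₂ # K₁
      x∪K₂#K₁ = #-∪ˡ (⁅⁆-# x∉K₁) (#-sym K₁#K₂)
    byCases (no ¬C~) = noGem record
      { hub = ⁅ z ⁆ ∪ K₂ ; a = W ; b = ⁅ x ⁆ ; c = K₁ ─ C ; d = C
      ; conn-hub = conn-∪ conn-⁅⁆ conn₂ (~⇒⁅⁆⟷ z~K₂) ; conn-a = connW ; conn-b = conn-⁅⁆
      ; conn-c = conn-─ conn₁ v∈K₁ sub closed ; conn-d = conn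
      ; hub⟷a = ⟷-mono ∪ˡ id (~⇒⁅⁆⟷ z~W)
      ; hub⟷b = ⟷-mono (∪ʳ {p = ⁅ z ⁆}) id (~⇒⟷⁅⁆ x~K₂)
      ; hub⟷c = ⟷-mono (∪ʳ {p = ⁅ z ⁆}) id (⟷-sym K₁─C⟷K₂)
      ; hub⟷d = ⟷-mono ∪ˡ id (~⇒⁅⁆⟷ z~C)
      ; a⟷b = ~⇒⟷⁅⁆ x~W
      ; b⟷c = let w , w∈ , e = x~K₁ in
              ~⇒⁅⁆⟷ (w , x∈p∧x∉q⇒x∈p─q w∈ (λ w∈C → ¬C~ (inj₁ (w , w∈C , e))) , e)
      ; c⟷d = ⟷-sym (⟷-mono id (sub⁅⁆ (x∈p∧x∉q⇒x∈p─q v∈K₁ v∉C)) C⟷v)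
      ; hub#a = #-∪ˡ (⁅⁆-# z∉W) (#-sym W#K₂)
      ; hub#b = #-∪ˡ (⁅⁆-#-⁅⁆ (≢-sym x≢z)) (#-sym (⁅⁆-# x∉K₂))
      ; hub#c = #-⊆ id (p─q⊆p K₁ C) z∪K₂#K₁
      ; hub#d = #-⊆ id C⊆K₁ z∪K₂#K₁
      ; a#b = #-sym (⁅⁆-# x∉W) ; b#c = #-⊆ id (p─q⊆p K₁ C) (⁅⁆-# x∉K₁) ; c#d = x∉p─q
      ; a∥c = ∥-⊆ id (p─q⊆p K₁ C) W∥K₁
      ; a∥d = ∥-⊆ id C⊆K₁ W∥K₁
      ; b∥d = ⁅⁆-∥ (x∉K₁ ∘ C⊆K₁) (¬C~ ∘ inj₁)
      }
      where
      z∪K₂#K₁ : ⁅ z ⁆ ∪ K₂ # K₁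
      z∪K₂#K₁ = #-∪ˡ (⁅⁆-# z∉K₁) (#-sym K₁#K₂)
      K₁─C⟷K₂ : K₁ ─ C ⟷ K₂
      K₁─C⟷K₂ with K₁⟷K₂
      ... | u , u∈ , u~ = u , x∈p∧x∉q⇒x∈p─q u∈ (λ u∈C → ¬C~ (inj₂ (u , u∈C , u~))) , u~

  -- Terminal holds on the cut isolating K.  If w ∈ K misses x but has a neighbour s ∈ K adjacent
  -- to x, then the component of K - s at w and the set ⁅ s ⁆ contradict theta.
  spread : ∀ {x z K W} {Terminal : Fin n → Set} →
    Conn K → Conn W → x ≢ z → x ∉ K → x ∉ W → z ∉ K → z ∉ W → x ~ K → x ~ W → z ~ W → W ∥ K →
    (∀ {u w} → u ∈ K → E G u w → w ∉ K → Terminal w) → Terminal x →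
    (∀ {v t} → v ∈ K → Terminal t → E G v t → E G v x × E G v z) →
    ∀ {v} → v ∈ K → E G v x × E G v z
  spread {x} {z} {K} {W} {Terminal} cK cW x≢z x∉K x∉W z∉K z∉W (k , k∈K , xk) x~W z~W W∥K leave Tx full {v} v∈K
    with E? v x
  ... | yes e = full v∈K Tx e
  ... | no ¬e with exit (λ u → ¬? (E? u x)) (cK v∈K k∈K) ¬e (λ ¬kx → ¬kx (Esym xk))
  ...   | w , s , ¬wx , ¬¬sx , (w∈K , s∈K , ws) with E? s x
  ...     | no ¬sx = contradiction ¬sx ¬¬sx
  ...     | yes sx with component (x∈p∧x≢y⇒x∈p-y w∈K (edge⇒≢ ws))
  -- By 2-connectedness the component leaves `K` without using `s`; the vertex `p` where it does so
  -- is next to a terminal, so `full` makes it adjacent to both `x` and `z`.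
  ...       | comp with exit (_∈? Component-of.C comp) (bypass (edge⇒≢ ws) (edge⇒≢ (Esym sx))) (Component-of.root comp) (x∉K ∘ p─q⊆p K _ ∘ Component-of.sub comp)
  ...         | p , q , p∈C , q∉C , (_ , q≢s , pq) =
    contradiction (Esym (theta t root (inj₂ (s , x∈⁅x⁆ s , ws)))) (¬wx ∘ Esym)
    where
    open Component-of comp
    C⊆K : C ⊆ K
    C⊆K r = p─q⊆p K _ (sub r)
    q∉K : q ∉ K
    q∉K q∈K = q∉C (closed p∈C (x∈p∧x≢y⇒x∈p-y q∈K q≢s) pq)
    p-full : E G p x × E G p z
    p-full = full (C⊆K p∈C) (leave (C⊆K p∈C) pq q∉K) pq
    s-full : E G s x × E G s z
    s-full = full s∈K Tx sx
    t : Theta z x C ⁅ s ⁆ W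
    t = record
      { conn₁ = conn ; conn₂ = conn-⁅⁆ ; connW = cW ; x≢z = ≢-sym x≢z
      ; x∉K₁ = z∉K ∘ C⊆K ; x∉K₂ = edge⇒≢ (Esym (proj₂ s-full)) ∘ ⁅⁆-elim ; x∉W = z∉W
      ; z∉K₁ = x∉K ∘ C⊆K ; z∉K₂ = edge⇒≢ (Esym sx) ∘ ⁅⁆-elim ; z∉W = x∉W
      ; x~K₁ = p , p∈C , Esym (proj₂ p-full) ; x~K₂ = s , x∈⁅x⁆ s , Esym (proj₂ s-full) ; x~W = z~W
      ; z~K₁ = p , p∈C , Esym (proj₁ p-full) ; z~K₂ = s , x∈⁅x⁆ s , Esym sx ; z~W = x~W
      ; K₁⟷K₂ = w , root , s , x∈⁅x⁆ s , ws
      ; K₁#K₂ = #-sym (⁅⁆-# (x∉p-x ∘ sub))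
      ; W∥K₁ = ∥-⊆ id C⊆K W∥K
      ; W#K₂ = #-sym (⁅⁆-# (λ s∈W → ∥⇒# W∥K s∈W s∈K))
      }

  -- With `O` as the third connection, `theta` applies to the two halves in either order and with
  -- `x` and `z` exchanged, so a vertex of `K` that sees one of `x` and `z` sees both. `spread`,
  -- with `x` and `z` as terminals, extends this to all of `K`.
  double⇒complete : ∀ {x z K O} → Side x z K → Double x z K →
    Conn O → x ∉ O → z ∉ O → x ~ O → z ~ O → K # O → ∀ {v} → v ∈ K → E G v x × E G v z
  double⇒complete {x} {z} {K} {O} side split cO x∉O z∉O x~O z~O K#O =
    spread conn cO x≢z x∉W x∉O z∉W z∉O x~W x~O z~O (∥-sym K∥O)
      (λ p e q → [ (λ r → contradiction r q) , id ]′ (closed p e)) (inj₁ refl)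
      (λ { v∈ (inj₁ refl) e → e , to-z v∈ e ; v∈ (inj₂ refl) e → to-x v∈ e , e })
    where
    open Side side
    open Split split
    K∥O : K ∥ O
    K∥O = Side-∥ side x∉O z∉O K#O
    K₁⟷K₂ : K₁ ⟷ K₂
    K₁⟷K₂ with A₁ | A₂
    ... | u , u∈ , _ | v , v∈ , _ with exit (_∈? K₁) (conn (sub₁ u∈) (sub₂ v∈)) u∈ (λ p → disjoint p v∈)
    ...   | p , q , p∈ , q∉ , (_ , q∈K , e) with cover q∈K
    ...     | inj₁ q∈ = contradiction q∈ q∉
    ...     | inj₂ q∈ = p , p∈ , q , q∈ , e
    meets⇒~ : ∀ {U y} → Meets U (λ v → E G v y) → y ~ U
    meets⇒~ (u , u∈ , e) = u , u∈ , Esym e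
    theta₁ : Theta x z K₁ K₂ O
    theta₁ = record
      { conn₁ = conn₁ ; conn₂ = conn₂ ; connW = cO ; x≢z = x≢z
      ; x∉K₁ = x∉W ∘ sub₁ ; x∉K₂ = x∉W ∘ sub₂ ; x∉W = x∉O ; z∉K₁ = z∉W ∘ sub₁ ; z∉K₂ = z∉W ∘ sub₂ ; z∉W = z∉O
      ; x~K₁ = meets⇒~ A₁ ; x~K₂ = meets⇒~ A₂ ; x~W = x~O ; z~K₁ = meets⇒~ B₁ ; z~K₂ = meets⇒~ B₂ ; z~W = z~O
      ; K₁⟷K₂ = K₁⟷K₂ ; K₁#K₂ = disjoint ; W∥K₁ = ∥-⊆ id sub₁ (∥-sym K∥O) ; W#K₂ = #-⊆ id sub₂ (#-sym K#O) }
    theta₂ : Theta x z K₂ K₁ O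
    theta₂ = record
      { conn₁ = conn₂ ; conn₂ = conn₁ ; connW = cO ; x≢z = x≢z
      ; x∉K₁ = x∉W ∘ sub₂ ; x∉K₂ = x∉W ∘ sub₁ ; x∉W = x∉O ; z∉K₁ = z∉W ∘ sub₂ ; z∉K₂ = z∉W ∘ sub₁ ; z∉W = z∉O
      ; x~K₁ = meets⇒~ A₂ ; x~K₂ = meets⇒~ A₁ ; x~W = x~O ; z~K₁ = meets⇒~ B₂ ; z~K₂ = meets⇒~ B₁ ; z~W = z~O
      ; K₁⟷K₂ = ⟷-sym K₁⟷K₂ ; K₁#K₂ = #-sym disjoint ; W∥K₁ = ∥-⊆ id sub₂ (∥-sym K∥O) ; W#K₂ = #-⊆ id sub₁ (#-sym K#O) }
    to-z : ∀ {v} → v ∈ K → E G v x → E G v z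
    to-z v∈ e = [ (λ p → theta theta₁ p (inj₁ e)) , (λ p → theta theta₂ p (inj₁ e)) ]′ (cover v∈)
    to-x : ∀ {v} → v ∈ K → E G v z → E G v x
    to-x v∈ e = [ (λ p → theta (Theta-swap theta₁) p (inj₁ e)) , (λ p → theta (Theta-swap theta₂) p (inj₁ e)) ]′ (cover v∈)

  -- Sides with two disjoint connections outside

  record Anchored (x z : Fin n) (W : Subset n) : Set where
    field
      X Z O : Subset n
      connX : Conn X
      connZ : Conn Z
      connO : Conn O
      x∈X : x ∈ X
      z∈Z : z ∈ Z
      X⟷Z : X ⟷ Z
      O⟷X : O ⟷ X
      O⟷Z : O ⟷ Z
      X#Z : X # Z
      O#X : O # X
      O#Z : O # Z
      X#W : X # W
      Z#W : Z # W
      O#W : O # W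

  Anchored-swap : ∀ {x z W} → Anchored x z W → Anchored z x W
  Anchored-swap a = record
    { X = Z ; Z = X ; O = O ; connX = connZ ; connZ = connX ; connO = connO ; x∈X = z∈Z ; z∈Z = x∈X
    ; X⟷Z = ⟷-sym X⟷Z ; O⟷X = O⟷Z ; O⟷Z = O⟷X ; X#Z = #-sym X#Z ; O#X = O#Z ; O#Z = O#X
    ; X#W = Z#W ; Z#W = X#W ; O#W = O#W }
    where open Anchored a

  -- The hub `X` with the path `Q`, `B`, `Z`, `O` is a gem: outside `W` the only possible neighbour
  -- of `Q` is `x`, so it misses `Z`, and all of `W` misses `O`.
  anchored-split : ∀ {x z W Q B} → Side x z W → Anchored x z W → Q ⊆ W → B ⊆ W → Q # B →
    Conn Q → Conn B → Q ⟷ B → x ~ Q → z ≁ Q → x ~ B → z ~ B → ⊥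
  anchored-split {x} {z} {W} {Q} {B} side anchored Q⊆W B⊆W Q#B cQ cB Q⟷B x~Q z≁Q x~B z~B = noGem record
    { hub = X ; a = Q ; b = B ; c = Z ; d = O
    ; conn-hub = connX ; conn-a = cQ ; conn-b = cB ; conn-c = connZ ; conn-d = connO
    ; hub⟷a = ~⇒⟷ x∈X x~Q ; hub⟷b = ~⇒⟷ x∈X x~B ; hub⟷c = X⟷Z ; hub⟷d = ⟷-sym O⟷X
    ; a⟷b = Q⟷B ; b⟷c = ⟷-sym (~⇒⟷ z∈Z z~B) ; c⟷d = ⟷-sym O⟷Z
    ; hub#a = #-⊆ id Q⊆W X#W ; hub#b = #-⊆ id B⊆W X#W ; hub#c = X#Z ; hub#d = #-sym O#X
    ; a#b = Q#B ; b#c = #-⊆ B⊆W id (#-sym Z#W) ; c#d = #-sym O#Z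
    ; a∥c = ∥-intro (#-⊆ Q⊆W id (#-sym Z#W)) ¬Q⟷Z
    ; a∥d = ∥-⊆ Q⊆W id W∥O
    ; b∥d = ∥-⊆ B⊆W id W∥O
    }
    where
    open Side side using (closed)
    open Anchored anchored
    W∥O : W ∥ O
    W∥O = Side-∥ side (λ p → O#X p x∈X) (λ p → O#Z p z∈Z) (#-sym O#W)
    ¬Q⟷Z : ¬ Q ⟷ Z
    ¬Q⟷Z (u , u∈Q , w , w∈Z , e) with closed (Q⊆W u∈Q) e
    ... | inj₁ w∈W = Z#W w∈Z w∈W
    ... | inj₂ (inj₁ refl) = X#Z x∈X w∈Z
    ... | inj₂ (inj₂ refl) = z≁Q (u , u∈Q , Esym e)

  anchored⇒double⊎path : ∀ {x z W} → Side x z W → Anchored x z W → Double x z W ⊎ PathSide x z W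
  anchored⇒double⊎path {x₀} {z₀} {W₀} side₀ anchored₀ =
    thin⇒path Φ (Double x₀ z₀ W₀) (λ φ → proj₁ φ)
      (λ { (s , a , d) → Side-swap s , Anchored-swap a , d ∘ Double-swap })
      (λ { (_ , _ , d) → d }) sub (side₀ , anchored₀ , id)
    where
    -- The third component turns a double side into doubleness of the initial one; for smaller sides
    -- it is vacuous, as `¬double` shows.
    Φ : Fin n → Fin n → Subset n → Set
    Φ x z W = Side x z W × Anchored x z W × (Double x z W → Double x₀ z₀ W₀)
    sub : ∀ {x z W c D} → Φ x z W → c ∈ W → c separates x from z in′ W → Side x c D → D ⊆ W - c → z ≁ D →
      (∀ {u} → u ∈ W → E G x u → u ∈ D) × Φ x c D
    sub {x} {z} {W} {c} {D} (side , anchored , _) c∈W _ sideD D⊆ z≁D = unique , sideD , anchored′ , ⊥-elim ∘ ¬double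
      where
      open Side side
      module D = Side sideD
      open Anchored anchored
      D⊆W : D ⊆ W
      D⊆W p = p─q⊆p W _ (D⊆ p)
      B = W ─ D
      B⊆W : B ⊆ W
      B⊆W = p─q⊆p W D
      c∈B : c ∈ B
      c∈B = x∈p∧x∉q⇒x∈p─q c∈W D.z∉W
      cB : Conn B
      cB = conn-─ conn c∈W D⊆ λ p q e → [ id , [ (λ { refl → contradiction (p─q⊆p W _ q) x∉W }) , (λ { refl → contradiction q x∉p-x }) ]′ ]′ (D.closed p e)
      z~B : z ~ B
      z~B = let w , w∈ , e = z~W in w , x∈p∧x∉q⇒x∈p─q w∈ (λ w∈D → z≁D (w , w∈D , e)) , e
      D⟷B : D ⟷ B
      D⟷B = ⟷-sym (~⇒⟷ c∈B D.z~W)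
      -- A neighbour of `x` in `B` would let `anchored-split` apply to `D` and `B`.
      unique : ∀ {u} → u ∈ W → E G x u → u ∈ D
      unique {u} u∈W e with u ∈? D
      ... | yes u∈D = u∈D
      ... | no  u∉D = ⊥-elim (anchored-split side anchored D⊆W B⊆W (#-sym x∉p─q) D.conn cB D⟷B D.x~W z≁D
                               (u , x∈p∧x∉q⇒x∈p─q u∈W u∉D , e) z~B)
      -- `B` connects `c` to `z`, so it is added to `Z` and the smaller side stays anchored.
      anchored′ : Anchored x c D
      anchored′ = record
        { X = X ; Z = B ∪ Z ; O = O ; connX = connX ; connZ = conn-∪ cB connZ (⟷-sym (~⇒⟷ z∈Z z~B)) ; connO = connO
        ; x∈X = x∈X ; z∈Z = ∪ˡ c∈B ; X⟷Z = ⟷-mono id (∪ʳ {p = B}) X⟷Z ; O⟷X = O⟷X ; O⟷Z = ⟷-mono id (∪ʳ {p = B}) O⟷Z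
        ; X#Z = #-sym (#-∪ˡ (#-⊆ B⊆W id (#-sym X#W)) (#-sym X#Z)) ; O#X = O#X
        ; O#Z = #-sym (#-∪ˡ (#-⊆ B⊆W id (#-sym O#W)) (#-sym O#Z))
        ; X#W = #-⊆ id D⊆W X#W ; Z#W = #-∪ˡ x∉p─q (#-⊆ id D⊆W Z#W) ; O#W = #-⊆ id D⊆W O#W }
      ¬double : ¬ Double x c D
      -- One half of `D` plays `Q`; the other half, joined to `B` through `c`, plays the second set.
      ¬double s = anchored-split side anchored (D⊆W ∘ sub₁) (λ p → ∪-elim (D⊆W ∘ sub₂) B⊆W p)
        (#-sym (#-∪ˡ (#-sym disjoint) (#-⊆ id sub₁ x∉p─q)))
        conn₁ (conn-∪ conn₂ cB (near B₂)) (⟷-mono id (∪ʳ {p = K₂}) (near B₁))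
        (let u , u∈ , e = A₁ in u , u∈ , Esym e) (λ t → z≁D (~-mono sub₁ t))
        (let u , u∈ , e = A₂ in u , ∪ˡ u∈ , Esym e) (~-mono (∪ʳ {p = K₂}) z~B)
        where
        open Split s
        near : ∀ {K} → Meets K (λ v → E G v c) → K ⟷ B
        near (u , u∈ , e) = u , u∈ , c , c∈B , e

  -- From good components to the set `X`

  Result : Set
  Result = Σ (Subset n) λ X → ∣ X ∣ ≤ 6 ×
    ((v : Fin n) → v ∉ X → IsCographOn G (Component G X v) ⊎ IsPathDeg2On G (Component G X v))

  Good : Subset n → Set
  Good W = (∃ λ h → ∀ {v} → v ∈ W → E G v h) ⊎ (∃ λ x → ∃ λ z → Side x z W × PathSide x z W)

  finish : ∀ X → ∣ X ∣ ≤ 6 → (∀ v → v ∉ X → Σ (Component-of (∁ X) v) λ K → Good (Component-of.C K)) → Result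
  finish X X≤6 good = X , X≤6 , λ v v∉X → conclude (good v v∉X)
    where
    conclude : ∀ {v} → Σ (Component-of (∁ X) v) (λ K → Good (Component-of.C K)) →
      IsCographOn G (Component G X v) ⊎ IsPathDeg2On G (Component G X v)
    conclude (K , good) = [ (λ { (_ , dom) → inj₁ (dominated⇒noP4 (λ s → dom (to s))) })
                          , (λ { (_ , _ , side , path) → inj₂ (PathSide⇒path side path (λ w → mk⇔ to from)) }) ]′ good
      where
      to : ∀ {w} → Component G X _ w → w ∈ Component-of.C K
      to s = reach⇒∈ K (Star.map (λ { (p , q , e) → x∉p⇒x∈∁p p , x∉p⇒x∈∁p q , e }) s)
      from : ∀ {w} → w ∈ Component-of.C K → Component G X _ w
      from w∈ = Star.map (λ { (p , q , e) → x∈∁p⇒x∉p p , x∈∁p⇒x∉p q , e }) (∈⇒reach K w∈)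

  Outside : Fin n → Fin n → Subset n
  Outside x z = ∁ (⁅ x ⁆ ∪ ⁅ z ⁆)

  outside⁺ : ∀ {x z w} → w ≢ x → w ≢ z → w ∈ Outside x z
  outside⁺ w≢x w≢z = x∉p⇒x∈∁p (∪-elim (w≢x ∘ ⁅⁆-elim) (w≢z ∘ ⁅⁆-elim))

  outside⁻ : ∀ {x z w} → w ∈ Outside x z → w ≢ x × w ≢ z
  outside⁻ {x} {z} w∈ = (λ { refl → x∈∁p⇒x∉p w∈ (∪ˡ (x∈⁅x⁆ x)) }) , (λ { refl → x∈∁p⇒x∉p w∈ (∪ʳ {p = ⁅ x ⁆} (x∈⁅x⁆ z)) })

  ∣pair∣≤6 : ∀ (x z : Fin n) → ∣ ⁅ x ⁆ ∪ ⁅ z ⁆ ∣ ≤ 6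
  ∣pair∣≤6 x z = ℕ.≤-trans (∣⁅x⁆∪q∣≤ x (ℕ.≤-reflexive (∣⁅x⁆∣≡1 z))) (s≤s (s≤s z≤n))

  -- If `C` did not see `p`, then `q` alone would cut it off from `p`, against 2-connectedness.
  near : ∀ {p q v C} → v ∈ C → v ≢ q → p ≢ q → p ∉ C →
    (∀ {u w} → u ∈ C → w ≢ p → w ≢ q → E G u w → w ∈ C) → p ~ C
  near {p} {C = C} v∈C v≢q p≢q p∉C closed with exit (_∈? C) (bypass v≢q p≢q) v∈C p∉C
  ... | a , b , a∈C , b∉C , (_ , b≢q , e) with b ≟ p
  ...   | yes refl = a , a∈C , Esym e
  ...   | no b≢p = contradiction (closed a∈C b≢p b≢q e) b∉C

  component-side : ∀ {x z v} → x ≢ z → (K : Component-of (Outside x z) v) → Side x z (Component-of.C K)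
  component-side {x} {z} x≢z K = record
    { conn = conn ; x≢z = x≢z ; x∉W = x∉C ; z∉W = z∉C
    ; x~W = near root (proj₂ (outside⁻ (sub root))) x≢z x∉C (λ u∈ w≢x w≢z → closed u∈ (outside⁺ w≢x w≢z))
    ; z~W = near root (proj₁ (outside⁻ (sub root))) (≢-sym x≢z) z∉C (λ u∈ w≢z w≢x → closed u∈ (outside⁺ w≢x w≢z))
    ; closed = close
    }
    where
    open Component-of K
    x∉C : x ∉ C
    x∉C p = proj₁ (outside⁻ (sub p)) refl
    z∉C : z ∉ C
    z∉C p = proj₂ (outside⁻ {x} (sub p)) refl
    close : ∀ {u w} → u ∈ C → E G u w → w ∈ C ⊎ w ≡ x ⊎ w ≡ z
    close {w = w} u∈ e with w ≟ x | w ≟ z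
    ... | yes p | _ = inj₂ (inj₁ p)
    ... | _ | yes p = inj₂ (inj₂ p)
    ... | no p | no q = inj₁ (closed u∈ (outside⁺ p q) e)

  side-component : ∀ {x z v W} → Side x z W → v ∈ W → Component-of (Outside x z) v
  side-component {W = W} side v∈W = record
    { C = W ; root = v∈W ; sub = λ p → outside⁺ (λ { refl → x∉W p }) (λ { refl → z∉W p }) ; conn = conn
    ; closed = λ u∈ w∈ e → [ id , [ (λ p → contradiction p (proj₁ (outside⁻ w∈))) , (λ p → contradiction p (proj₂ (outside⁻ w∈))) ]′ ]′ (closed u∈ e) }
    where open Side side

  component-# : ∀ {S v v′} (K : Component-of S v) (K′ : Component-of S v′) →
    v′ ∉ Component-of.C K → Component-of.C K′ # Component-of.C K
  component-# K K′ v′∉ p q = v′∉ (reach⇒∈ K (∈⇒reach K q ◅◅ reach-sym (∈⇒reach K′ p)))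

  record Bridge (x z : Fin n) (C O : Subset n) : Set where
    field
      connO : Conn O
      x∉O : x ∉ O
      z∉O : z ∉ O
      x~O : x ~ O
      z~O : z ~ O
      O#C : O # C

  side⇒bridge : ∀ {x z C O} → Side x z O → O # C → Bridge x z C O
  side⇒bridge s O#C = record { connO = conn ; x∉O = x∉W ; z∉O = z∉W ; x~O = x~W ; z~O = z~W ; O#C = O#C }
    where open Side s

  anchored-edge : ∀ {x z C O} → Side x z C → E G x z → Bridge x z C O → Anchored x z C
  anchored-edge {x} {z} {O = O} s e b = record
    { X = ⁅ x ⁆ ; Z = ⁅ z ⁆ ; O = O ; connX = conn-⁅⁆ ; connZ = conn-⁅⁆ ; connO = connO
    ; x∈X = x∈⁅x⁆ x ; z∈Z = x∈⁅x⁆ z ; X⟷Z = edge⟷ e ; O⟷X = ~⇒⟷⁅⁆ x~O ; O⟷Z = ~⇒⟷⁅⁆ z~O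
    ; X#Z = ⁅⁆-#-⁅⁆ x≢z ; O#X = #-sym (⁅⁆-# x∉O) ; O#Z = #-sym (⁅⁆-# z∉O)
    ; X#W = ⁅⁆-# x∉W ; Z#W = ⁅⁆-# z∉W ; O#W = O#C }
    where
    open Side s
    open Bridge b

  -- The first bridge is added to `x`, which makes `X` touch `z`; the second one remains as `O`.
  anchored-bridges : ∀ {x z C O₁ O₂} → Side x z C → Bridge x z C O₁ → Bridge x z C O₂ → O₁ # O₂ → Anchored x z C
  anchored-bridges {x} {z} {O₁ = O₁} {O₂} s b₁ b₂ O₁#O₂ = record
    { X = ⁅ x ⁆ ∪ O₁ ; Z = ⁅ z ⁆ ; O = O₂
    ; connX = conn-∪ conn-⁅⁆ B₁.connO (~⇒⁅⁆⟷ B₁.x~O) ; connZ = conn-⁅⁆ ; connO = B₂.connO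
    ; x∈X = ∪ˡ (x∈⁅x⁆ x) ; z∈Z = x∈⁅x⁆ z
    ; X⟷Z = ⟷-mono (∪ʳ {p = ⁅ x ⁆}) id (~⇒⟷⁅⁆ B₁.z~O) ; O⟷X = ⟷-mono id ∪ˡ (~⇒⟷⁅⁆ B₂.x~O) ; O⟷Z = ~⇒⟷⁅⁆ B₂.z~O
    ; X#Z = #-∪ˡ (⁅⁆-#-⁅⁆ x≢z) (#-sym (⁅⁆-# B₁.z∉O)) ; O#X = #-sym (#-∪ˡ (⁅⁆-# B₂.x∉O) O₁#O₂) ; O#Z = #-sym (⁅⁆-# B₂.z∉O)
    ; X#W = #-∪ˡ (⁅⁆-# x∉W) B₁.O#C ; Z#W = ⁅⁆-# z∉W ; O#W = B₂.O#C }
    where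
    open Side s
    module B₁ = Bridge b₁
    module B₂ = Bridge b₂

  good-double : ∀ {x z C O} → Side x z C → Bridge x z C O → Double x z C → Good C
  good-double {x} s b d = inj₁ (x , λ v∈ → proj₁ (double⇒complete s d connO x∉O z∉O x~O z~O (#-sym O#C) v∈))
    where open Bridge b

  good-piece : ∀ {x z C O} → Side x z C → Anchored x z C → Bridge x z C O → Good C
  good-piece s a b = [ good-double s b , (λ p → inj₂ (_ , _ , s , p)) ]′ (anchored⇒double⊎path s a)

  from-pair : ∀ {x z} → x ≢ z → (∀ {v} (K : Component-of (Outside x z) v) → Good (Component-of.C K)) → Result
  from-pair {x} {z} x≢z good = finish (⁅ x ⁆ ∪ ⁅ z ⁆) (∣pair∣≤6 x z)
    λ v v∉ → component (x∉p⇒x∈∁p v∉) , good (component (x∉p⇒x∈∁p v∉))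

  -- Exceptional cut pairs

  Sep : Subset n → Fin n → Fin n → Set
  Sep S u w = u ∈ S × w ∈ S × ¬ Star (Step S) u w

  Sep? : ∀ S u w → Dec (Sep S u w)
  Sep? S u w with u ∈? S | w ∈? S | reach? S u w
  ... | no u∉ | _ | _ = no (u∉ ∘ proj₁)
  ... | yes _ | no w∉ | _ = no (w∉ ∘ proj₁ ∘ proj₂)
  ... | yes _ | yes _ | yes (_ , s) = no (λ p → proj₂ (proj₂ p) s)
  ... | yes p | yes q | no ¬s = yes (p , q , λ s → ¬s (p , s))

  not-both : ∀ {S u w v} (K : Component-of S v) → Sep S u w → u ∈ Component-of.C K → w ∉ Component-of.C K
  not-both K (_ , _ , ¬s) u∈ w∈ = ¬s (reach-mono (Component-of.sub K) (Component-of.conn K u∈ w∈))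

  bridge : ∀ {x z v u} → x ≢ z → (K : Component-of (Outside x z) v) (u∈ : u ∈ Outside x z) → u ∉ Component-of.C K →
    Bridge x z (Component-of.C K) (Component-of.C (component u∈))
  bridge x≢z K u∈ u∉ = side⇒bridge (component-side x≢z (component u∈)) (component-# K (component u∈) u∉)

  sep-# : ∀ {S u w} ((u∈ , w∈ , _) : Sep S u w) → Component-of.C (component u∈) # Component-of.C (component w∈)
  sep-# (u∈ , w∈ , ¬s) p q = ¬s (∈⇒reach (component u∈) p ◅◅ reach-sym (∈⇒reach (component w∈) q))

  -- A component contains at most one of `u` and `w`. The component of the other one is a connection
  -- outside it, and the edge between `x` and `z` is a second.
  adjacent-cut : ∀ {x z u w} → x ≢ z → E G x z → Sep (Outside x z) u w → Result
  adjacent-cut {x} {z} {u} {w} x≢z e sep = from-pair x≢z good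
    where
    good : ∀ {v} (K : Component-of (Outside x z) v) → Good (Component-of.C K)
    good K with u ∈? Component-of.C K
    ... | no u∉ = good-piece s (anchored-edge s e b) b
      where
      s = component-side x≢z K
      b = bridge x≢z K (proj₁ sep) u∉
    ... | yes u∈ = good-piece s (anchored-edge s e b) b
      where
      s = component-side x≢z K
      b = bridge x≢z K (proj₁ (proj₂ sep)) (not-both K sep u∈)

  -- A component contains at most one of `u`, `w` and `t`, so the components of two others are
  -- disjoint connections outside it.
  triple-cut : ∀ {x z u w t} → x ≢ z → Sep (Outside x z) u w → Sep (Outside x z) u t → Sep (Outside x z) w t → Result
  triple-cut {x} {z} {u} {w} {t} x≢z uw ut wt = from-pair x≢z good
    where
    good : ∀ {v} (K : Component-of (Outside x z) v) → Good (Component-of.C K)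
    good K = byCases (u ∈? C) (w ∈? C)
      where
      open Component-of K using (C)
      s = component-side x≢z K
      avoiding : ∀ {p q} → Sep (Outside x z) p q → p ∉ C → q ∉ C → Good C
      avoiding pq p∉ q∉ = good-piece s (anchored-bridges s (bridge x≢z K (proj₁ pq) p∉) b (sep-# pq)) b
        where b = bridge x≢z K (proj₁ (proj₂ pq)) q∉
      byCases : Dec (u ∈ C) → Dec (w ∈ C) → Good C
      byCases (yes u∈) _ = avoiding wt (not-both K uw u∈) (not-both K ut u∈)
      byCases (no u∉) (yes w∈) = avoiding ut u∉ (not-both K wt w∈)
      byCases (no u∉) (no w∉) = avoiding uw u∉ w∉

  -- The two halves of `W` are disjoint connections for every other component. `W` itself is
  -- complete to `x` by `double⇒complete`, with the component of `o` as the connection outside.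
  double-cut : ∀ {x z W o} → Side x z W → o ∈ Outside x z → o ∉ W → Double x z W → Result
  double-cut {x} {z} {W} {o} side o∈ o∉W double = from-pair x≢z good
    where
    open Side side using (x≢z; x∉W; z∉W; x~W)
    open Split double
    W-comp : ∀ {v} → v ∈ W → Component-of (Outside x z) v
    W-comp = side-component side
    good : ∀ {v} (K : Component-of (Outside x z) v) → Good (Component-of.C K)
    good {v} K with v ∈? W
    ... | yes v∈W = inj₁ (x , λ p → proj₁ (complete (C⊆W p)))
      where
      b = bridge x≢z (W-comp v∈W) o∈ o∉W
      complete : ∀ {v} → v ∈ W → E G v x × E G v z
      complete = double⇒complete side double (Bridge.connO b) (Bridge.x∉O b) (Bridge.z∉O b) (Bridge.x~O b) (Bridge.z~O b) (#-sym (Bridge.O#C b))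
      C⊆W : Component-of.C K ⊆ W
      C⊆W p = reach⇒∈ (W-comp v∈W) (∈⇒reach K p)
    ... | no v∉W = good-piece s (anchored-bridges s (sub-bridge conn₁ sub₁ A₁ B₁) (sub-bridge conn₂ sub₂ A₂ B₂) disjoint) (side⇒bridge side W#C)
      where
      s = component-side x≢z K
      W#C : W # Component-of.C K
      W#C p q = v∉W (reach⇒∈ (W-comp p) (reach-sym (∈⇒reach K q)))
      sub-bridge : ∀ {O} → Conn O → O ⊆ W → Meets O (λ v → E G v x) → Meets O (λ v → E G v z) → Bridge x z (Component-of.C K) O
      sub-bridge cO O⊆W (a , a∈ , ax) (b , b∈ , bz) = record
        { connO = cO ; x∉O = x∉W ∘ O⊆W ; z∉O = z∉W ∘ O⊆W ; x~O = a , a∈ , Esym ax ; z~O = b , b∈ , Esym bz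
        ; O#C = #-⊆ O⊆W id W#C }

  -- Graphs whose cut pairs are not exceptional

  AdjacentCut : Set
  AdjacentCut = ∃ λ x → ∃ λ z → ∃ λ u → ∃ λ w → x ≢ z × E G x z × Sep (Outside x z) u w

  AdjacentCut? : Dec AdjacentCut
  AdjacentCut? = any? λ x → any? λ z → any? λ u → any? λ w → ¬? (x ≟ z) ×-dec E? x z ×-dec Sep? (Outside x z) u w

  TripleCut : Set
  TripleCut = ∃ λ x → ∃ λ z → ∃ λ u → ∃ λ w → ∃ λ t →
    x ≢ z × Sep (Outside x z) u w × Sep (Outside x z) u t × Sep (Outside x z) w t

  TripleCut? : Dec TripleCut
  TripleCut? = any? λ x → any? λ z → any? λ u → any? λ w → any? λ t →
    ¬? (x ≟ z) ×-dec Sep? (Outside x z) u w ×-dec Sep? (Outside x z) u t ×-dec Sep? (Outside x z) w t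

  Cut : Set
  Cut = ∃ λ x → ∃ λ z → ∃ λ u → ∃ λ w → x ≢ z × Sep (Outside x z) u w

  Cut? : Dec Cut
  Cut? = any? λ x → any? λ z → any? λ u → any? λ w → ¬? (x ≟ z) ×-dec Sep? (Outside x z) u w

  side-sep : ∀ {x z W u w} → Side x z W → u ∈ W → w ∈ Outside x z → w ∉ W → Sep (Outside x z) u w
  side-sep s u∈W w∈ w∉W = Component-of.sub (side-component s u∈W) u∈W , w∈ , λ p → w∉W (reach⇒∈ (side-component s u∈W) p)

  -- Every side met in the recursion belongs to a genuine cut pair, as `Φ` records by a vertex `o`
  -- beyond the side. Hence a double side is settled by `double-cut`, and if none occurs, both
  -- components are paths.
  thin-cut : ¬ AdjacentCut → ¬ TripleCut → Cut → Result
  thin-cut ¬adjacent ¬triple (x , z , u , w , x≢z , sep@(u∈ , w∈ , ¬s)) =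
    combine (path Ku (w , w∈ , λ p → ¬s (∈⇒reach Ku p)))
            (path Kw (u , u∈ , λ p → ¬s (reach-sym (∈⇒reach Kw p))))
    where
    Ku = component u∈
    Kw = component w∈
    Φ : Fin n → Fin n → Subset n → Set
    Φ x z W = Side x z W × ∃ λ o → o ∈ Outside x z × o ∉ W
    sub : ∀ {x z W c D} → Φ x z W → c ∈ W → c separates x from z in′ W → Side x c D → D ⊆ W - c → z ≁ D →
      (∀ {u} → u ∈ W → E G x u → u ∈ D) × Φ x c D
    sub {x} {z} {W} {c} {D} (side , _) c∈W sepc sideD D⊆ z≁D = unique , sideD , z , z∈ , z∉D
      where
      open Side side using (closed; x∉W; z∉W)
      module D = Side sideD
      z∈ : z ∈ Outside x c
      z∈ = outside⁺ (≢-sym (Side.x≢z side)) (λ { refl → z∉W c∈W })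
      z∉D : z ∉ D
      z∉D p = z∉W (p─q⊆p W _ (D⊆ p))
      unique : ∀ {u} → u ∈ W → E G x u → u ∈ D
      unique {u} u∈W xu with u ∈? D | u ≟ c | D.x~W
      ... | yes u∈D | _ | _ = u∈D
      -- Here `x` and `c` are adjacent and separate `D` from `z`: an adjacent cut.
      ... | no _ | yes refl | t , t∈D , _ = contradiction (x , c , t , z , D.x≢z , xu , side-sep sideD t∈D z∈ z∉D) ¬adjacent
      -- Here `t`, `u` and `z` lie in three different components once `x` and `c` are removed: a
      -- triple cut.
      ... | no u∉D | no u≢c | t , t∈D , _ = contradiction
        (x , c , t , u , z , D.x≢z , side-sep sideD t∈D u∈xc u∉D , side-sep sideD t∈D z∈ z∉D , (u∈xc , z∈ , ¬uz)) ¬triple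
        where
        u∈xc : u ∈ Outside x c
        u∈xc = outside⁺ (≢-sym (edge⇒≢ xu)) u≢c
        u∈W-c : u ∈ W - c
        u∈W-c = x∈p∧x≢y⇒x∈p-y u∈W u≢c
        M = component u∈W-c
        -- A walk from `u` to `z` avoiding `x` and `c` can leave the component of `u` in `W - c`
        -- only to `z`, but `c` separates the neighbours of `x` from those of `z`.
        ¬uz : ¬ Star (Step (Outside x c)) u z
        ¬uz s with exit (_∈? Component-of.C M) s (Component-of.root M) (z∉W ∘ p─q⊆p W _ ∘ Component-of.sub M)
        ... | p , q , p∈M , q∉M , (_ , q∈ , e) with closed (p─q⊆p W _ (Component-of.sub M p∈M)) e
        ...   | inj₁ q∈W = q∉M (Component-of.closed M p∈M (x∈p∧x≢y⇒x∈p-y q∈W (proj₂ (outside⁻ {x} q∈))) e)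
        ...   | inj₂ (inj₁ q≡x) = proj₁ (outside⁻ q∈) q≡x
        ...   | inj₂ (inj₂ refl) = sepc u∈W-c (Esym xu) e (∈⇒reach M p∈M)
    path : ∀ {v} (K : Component-of (Outside x z) v) → (∃ λ o → o ∈ Outside x z × o ∉ Component-of.C K) →
      Result ⊎ PathSide x z (Component-of.C K)
    path K o = thin⇒path Φ Result proj₁
      (λ { (s , o , o∈ , o∉) → Side-swap s , o , outside⁺ (proj₂ (outside⁻ o∈)) (proj₁ (outside⁻ o∈)) , o∉ })
      (λ { (s , o , o∈ , o∉) d → double-cut s o∈ o∉ d }) sub (component-side x≢z K , o)
    combine : Result ⊎ PathSide x z (Component-of.C Ku) → Result ⊎ PathSide x z (Component-of.C Kw) → Result
    combine (inj₁ r) _ = r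
    combine (inj₂ _) (inj₁ r) = r
    combine (inj₂ pu) (inj₂ pw) = finish (⁅ x ⁆ ∪ ⁅ z ⁆) (∣pair∣≤6 x z) good
      where
      su = component-side x≢z Ku
      sw = component-side x≢z Kw
      good : ∀ v → v ∉ ⁅ x ⁆ ∪ ⁅ z ⁆ → Σ (Component-of (Outside x z) v) λ K → Good (Component-of.C K)
      good v v∉ with v ∈? Component-of.C Ku | v ∈? Component-of.C Kw
      ... | yes v∈u | _ = side-component su v∈u , inj₂ (_ , _ , su , pu)
      ... | no _ | yes v∈w = side-component sw v∈w , inj₂ (_ , _ , sw , pw)
      -- A vertex on neither side would give a third component.
      ... | no v∉u | no v∉w = contradiction (x , z , u , w , v , x≢z , sep ,
              side-sep su (Component-of.root Ku) (x∉p⇒x∈∁p v∉) v∉u ,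
              side-sep sw (Component-of.root Kw) (x∉p⇒x∈∁p v∉) v∉w) ¬triple

  -- Graphs without cut pairs

  open Component-of

  -- `S` is the complement of the induced P₄, described only by its members, so that `mirror` can
  -- reverse the path and keep the same `S` with the same components.
  record Frame (a b c d : Fin n) (S : Subset n) : Set where
    field
      ab : E G a b
      bc : E G b c
      cd : E G c d
      ¬ac : ¬ E G a c
      ¬bd : ¬ E G b d
      ¬ad : ¬ E G a d
      in⁺ : ∀ {w} → w ≢ a → w ≢ b → w ≢ c → w ≢ d → w ∈ S
      a∉S : a ∉ S
      b∉S : b ∉ S
      c∉S : c ∉ S
      d∉S : d ∉ S

    a≢c : a ≢ c
    a≢c refl = ¬ad cd

    a≢d : a ≢ d
    a≢d refl = ¬ac (Esym cd)

    b≢d : b ≢ d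
    b≢d refl = ¬ad ab

    a≢b : a ≢ b
    a≢b = edge⇒≢ ab

    b≢c : b ≢ c
    b≢c = edge⇒≢ bc

    c≢d : c ≢ d
    c≢d = edge⇒≢ cd

    ∉S : ∀ {w} → w ∉ S → w ≡ a ⊎ w ≡ b ⊎ w ≡ c ⊎ w ≡ d
    ∉S {w} w∉S with w ≟ a | w ≟ b | w ≟ c | w ≟ d
    ... | yes p | _ | _ | _ = inj₁ p
    ... | _ | yes p | _ | _ = inj₂ (inj₁ p)
    ... | _ | _ | yes p | _ = inj₂ (inj₂ (inj₁ p))
    ... | _ | _ | _ | yes p = inj₂ (inj₂ (inj₂ p))
    ... | no p | no q | no r | no s = contradiction (in⁺ p q r s) w∉S

  mirror : ∀ {a b c d S} → Frame a b c d S → Frame d c b a S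
  mirror f = record
    { ab = Esym cd ; bc = Esym bc ; cd = Esym ab ; ¬ac = ¬bd ∘ Esym ; ¬bd = ¬ac ∘ Esym ; ¬ad = ¬ad ∘ Esym
    ; in⁺ = λ p q r s → in⁺ s r q p ; a∉S = d∉S ; b∉S = c∉S ; c∉S = b∉S ; d∉S = a∉S }
    where open Frame f

  component-∥ : ∀ {S v v′} (K : Component-of S v) (K′ : Component-of S v′) → v′ ∉ C K → C K′ ∥ C K
  component-∥ K K′ v′∉ = ∥-intro (component-# K K′ v′∉)
    λ { (u , u∈ , w , w∈ , e) → component-# K K′ v′∉ u∈ (closed K w∈ (sub K′ u∈) (Esym e)) }

  ⁅⁆-∥-⁅⁆ : ∀ {u v} → u ≢ v → ¬ E G u v → ⁅ u ⁆ ∥ ⁅ v ⁆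
  ⁅⁆-∥-⁅⁆ u≢v ¬e p q with ⁅⁆-elim p | ⁅⁆-elim q
  ... | refl | refl = u≢v , ¬e

  ∉C : ∀ {S v w} (K : Component-of S v) → w ∉ S → w ∉ C K
  ∉C K w∉S w∈C = w∉S (sub K w∈C)

  module _ {a b c d S} (f : Frame a b c d S) where
    open Frame f

    -- The component would be the hub of a gem over the path.
    not-all : ∀ {v} (K : Component-of S v) → a ~ C K → b ~ C K → c ~ C K → d ~ C K → ⊥
    not-all K a~ b~ c~ d~ = noGem record
      { hub = C K ; a = ⁅ a ⁆ ; b = ⁅ b ⁆ ; c = ⁅ c ⁆ ; d = ⁅ d ⁆
      ; conn-hub = conn K ; conn-a = conn-⁅⁆ ; conn-b = conn-⁅⁆ ; conn-c = conn-⁅⁆ ; conn-d = conn-⁅⁆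
      ; hub⟷a = ~⇒⟷⁅⁆ a~ ; hub⟷b = ~⇒⟷⁅⁆ b~ ; hub⟷c = ~⇒⟷⁅⁆ c~ ; hub⟷d = ~⇒⟷⁅⁆ d~
      ; a⟷b = edge⟷ ab ; b⟷c = edge⟷ bc ; c⟷d = edge⟷ cd
      ; hub#a = off a∉S ; hub#b = off b∉S ; hub#c = off c∉S ; hub#d = off d∉S
      ; a#b = ⁅⁆-#-⁅⁆ a≢b ; b#c = ⁅⁆-#-⁅⁆ b≢c ; c#d = ⁅⁆-#-⁅⁆ c≢d
      ; a∥c = ⁅⁆-∥-⁅⁆ a≢c ¬ac ; a∥d = ⁅⁆-∥-⁅⁆ a≢d ¬ad ; b∥d = ⁅⁆-∥-⁅⁆ b≢d ¬bd
      }
      where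
      off : ∀ {w} → w ∉ S → C K # ⁅ w ⁆
      off w∉S = #-sym (⁅⁆-# (∉C K w∉S))

    -- With `b` and `c` as the hub, the path `C K`, `a`, `C K′`, `d` is a gem; `C K` misses `d` by
    -- `not-all`, which also excludes that the two components coincide.
    abc-abd : ∀ {v v′} (K : Component-of S v) (K′ : Component-of S v′) →
      a ~ C K → b ~ C K → c ~ C K → a ~ C K′ → b ~ C K′ → d ~ C K′ → ⊥
    abc-abd {v} {v′} K K′ aK bK cK aK′ bK′ dK′ with v′ ∈? C K
    ... | yes v′∈ = not-all K aK bK cK (~-mono (λ p → reach⇒∈ K (∈⇒reach K v′∈ ◅◅ ∈⇒reach K′ p)) dK′)
    ... | no v′∉ = noGem record
      { hub = ⁅ b ⁆ ∪ ⁅ c ⁆ ; a = C K ; b = ⁅ a ⁆ ; c = C K′ ; d = ⁅ d ⁆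
      ; conn-hub = conn-∪ conn-⁅⁆ conn-⁅⁆ (edge⟷ bc) ; conn-a = conn K ; conn-b = conn-⁅⁆ ; conn-c = conn K′ ; conn-d = conn-⁅⁆
      ; hub⟷a = ⟷-mono ∪ˡ id (~⇒⁅⁆⟷ bK) ; hub⟷b = ⟷-mono ∪ˡ id (edge⟷ (Esym ab))
      ; hub⟷c = ⟷-mono ∪ˡ id (~⇒⁅⁆⟷ bK′) ; hub⟷d = ⟷-mono (∪ʳ {p = ⁅ b ⁆}) id (edge⟷ cd)
      ; a⟷b = ~⇒⟷⁅⁆ aK ; b⟷c = ~⇒⁅⁆⟷ aK′ ; c⟷d = ~⇒⟷⁅⁆ dK′
      ; hub#a = #-∪ˡ (⁅⁆-# (∉C K b∉S)) (⁅⁆-# (∉C K c∉S))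
      ; hub#b = #-∪ˡ (⁅⁆-#-⁅⁆ (≢-sym a≢b)) (⁅⁆-#-⁅⁆ (≢-sym a≢c))
      ; hub#c = #-∪ˡ (⁅⁆-# (∉C K′ b∉S)) (⁅⁆-# (∉C K′ c∉S))
      ; hub#d = #-∪ˡ (⁅⁆-#-⁅⁆ b≢d) (⁅⁆-#-⁅⁆ c≢d)
      ; a#b = #-sym (⁅⁆-# (∉C K a∉S)) ; b#c = ⁅⁆-# (∉C K′ a∉S) ; c#d = #-sym (⁅⁆-# (∉C K′ d∉S))
      ; a∥c = ∥-sym (component-∥ K K′ v′∉)
      ; a∥d = ∥-sym (⁅⁆-∥ (∉C K d∉S) (not-all K aK bK cK))
      ; b∥d = ⁅⁆-∥-⁅⁆ a≢d ¬ad
      }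

    -- The edge between `b` and `c` connects `a` to `d`, and so does `C K′`; hence `theta` shows
    -- that a vertex of `C K` next to `a`, `b` or `d` sees both `a` and `d`. These three are the
    -- terminals of `spread`, since `not-all` keeps `c` away from `C K`.
    abd⇒dominated : ∀ {v v′} (K : Component-of S v) (K′ : Component-of S v′) →
      a ~ C K → b ~ C K → d ~ C K → a ~ C K′ → c ~ C K′ → d ~ C K′ → ∀ {w} → w ∈ C K → E G w a
    abd⇒dominated {v} {v′} K K′ aK bK dK aK′ cK′ dK′ w∈ = proj₁ (spread {Terminal = λ t → t ≡ a ⊎ t ≡ b ⊎ t ≡ d}
      (conn K) (conn K′) a≢d (∉C K a∉S) (∉C K′ a∉S) (∉C K d∉S) (∉C K′ d∉S) aK aK′ dK′ K′∥K leave (inj₁ refl) full w∈)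
      where
      c≁K : c ≁ C K
      c≁K cK = not-all K aK bK cK dK
      v′∉K : v′ ∉ C K
      v′∉K v′∈ = c≁K (~-mono (λ p → reach⇒∈ K (∈⇒reach K v′∈ ◅◅ ∈⇒reach K′ p)) cK′)
      K′∥K : C K′ ∥ C K
      K′∥K = component-∥ K K′ v′∉K
      leave : ∀ {u w} → u ∈ C K → E G u w → w ∉ C K → w ≡ a ⊎ w ≡ b ⊎ w ≡ d
      leave {u} {w} u∈ e w∉ with w ∈? S
      ... | yes w∈S = contradiction (closed K u∈ w∈S e) w∉
      ... | no w∉S with ∉S w∉S
      ...   | inj₁ p = inj₁ p
      ...   | inj₂ (inj₁ p) = inj₂ (inj₁ p)
      ...   | inj₂ (inj₂ (inj₁ refl)) = contradiction (u , u∈ , Esym e) c≁K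
      ...   | inj₂ (inj₂ (inj₂ p)) = inj₂ (inj₂ p)
      b∪c = ⁅ b ⁆ ∪ ⁅ c ⁆
      b∈b∪c : b ∈ b∪c
      b∈b∪c = ∪ˡ (x∈⁅x⁆ b)
      c∈b∪c : c ∈ b∪c
      c∈b∪c = ∪ʳ {p = ⁅ b ⁆} (x∈⁅x⁆ c)
      t : Theta d a (C K) b∪c (C K′)
      t = record
        { conn₁ = conn K ; conn₂ = conn-∪ conn-⁅⁆ conn-⁅⁆ (edge⟷ bc) ; connW = conn K′ ; x≢z = ≢-sym a≢d
        ; x∉K₁ = ∉C K d∉S ; x∉K₂ = ∪-elim (≢-sym b≢d ∘ ⁅⁆-elim) (≢-sym c≢d ∘ ⁅⁆-elim) ; x∉W = ∉C K′ d∉S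
        ; z∉K₁ = ∉C K a∉S ; z∉K₂ = ∪-elim (a≢b ∘ ⁅⁆-elim) (a≢c ∘ ⁅⁆-elim) ; z∉W = ∉C K′ a∉S
        ; x~K₁ = dK ; x~K₂ = c , c∈b∪c , Esym cd ; x~W = dK′
        ; z~K₁ = aK ; z~K₂ = b , b∈b∪c , ab ; z~W = aK′
        ; K₁⟷K₂ = ⟷-mono id ∪ˡ (~⇒⟷⁅⁆ bK)
        ; K₁#K₂ = #-sym (#-∪ˡ (⁅⁆-# (∉C K b∉S)) (⁅⁆-# (∉C K c∉S)))
        ; W∥K₁ = K′∥K
        ; W#K₂ = #-sym (#-∪ˡ (⁅⁆-# (∉C K′ b∉S)) (⁅⁆-# (∉C K′ c∉S)))
        }
      full : ∀ {w t} → w ∈ C K → t ≡ a ⊎ t ≡ b ⊎ t ≡ d → E G w t → E G w a × E G w d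
      full w∈ (inj₁ refl) e = e , theta (Theta-swap t) w∈ (inj₁ e)
      full w∈ (inj₂ (inj₁ refl)) e = theta t w∈ (inj₂ (b , b∈b∪c , e)) , theta (Theta-swap t) w∈ (inj₂ (b , b∈b∪c , e))
      full w∈ (inj₂ (inj₂ refl)) e = theta t w∈ (inj₁ e) , e

  module _ (¬cut : ¬ Cut) where

    linked : ∀ {x z u w} → x ≢ z → u ≢ x → u ≢ z → w ≢ x → w ≢ z → Star (Step (Outside x z)) u w
    linked {x} {z} {u} {w} x≢z u≢x u≢z w≢x w≢z with reach? (Outside x z) u w
    ... | yes (_ , s) = s
    ... | no ¬s = contradiction (x , z , u , w , x≢z , outside⁺ u≢x u≢z , outside⁺ w≢x w≢z , λ s → ¬s (outside⁺ u≢x u≢z , s)) ¬cut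

    -- Without a third attachment, `p` and `q` would cut the component off from `s`.
    third : ∀ {S v} (K : Component-of S v) {p q s} → p ∉ S → q ∉ S → s ∉ S → p ≢ q → s ≢ p → s ≢ q →
      ∃ λ r → r ∉ S × r ≢ p × r ≢ q × r ~ C K
    third {S} {v} K {p} {q} {s} p∉ q∉ s∉ p≢q s≢p s≢q
      with exit (_∈? C K) (linked p≢q (root≢ p∉) (root≢ q∉) s≢p s≢q) (root K) (∉C K s∉)
      where
      root≢ : ∀ {w} → w ∉ S → v ≢ w
      root≢ w∉ refl = w∉ (sub K (root K))
    ... | y , r , y∈ , r∉ , (_ , r∈ , e) =
      r , (λ r∈S → r∉ (closed K y∈ r∈S e)) , proj₁ (outside⁻ r∈) , proj₂ (outside⁻ {p} r∈) , y , y∈ , Esym e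

    -- Since `r` and `s` are not a cut pair, a walk joins `p` to `q` without them; as `p` and `q`
    -- are not adjacent, it reaches `q` from a component of `S` that is attached to `p`.
    connect : ∀ {S p q r s} → (∀ {w} → w ∉ S → w ≡ p ⊎ w ≡ q ⊎ w ≡ r ⊎ w ≡ s) →
      p ≢ q → p ≢ r → p ≢ s → q ≢ r → q ≢ s → r ≢ s → q ∉ S → ¬ E G p q →
      ∃ λ v → Σ (Component-of S v) λ K → p ~ C K × q ~ C K
    connect {S} {p} {q} {r} {s} ∉S p≢q p≢r p≢s q≢r q≢s r≢s q∉S ¬pq
      with any? (λ v → any? λ t → E? p v ×-dec E? q t ×-dec reach? S v t)
    ... | yes (v , t , pv , qt , v∈S , π) = v , component v∈S , (v , root (component v∈S) , pv) , (t , reach⇒∈ (component v∈S) π , qt)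
    ... | no none = ⊥-elim (escape (exit Hit? (linked r≢s p≢r p≢s q≢r q≢s) (inj₁ refl) ¬Hit-q))
      where
      Hit : Fin n → Set
      Hit w = w ≡ p ⊎ ∃ λ v → E G p v × v ∈ S × Star (Step S) v w
      Hit? : ∀ w → Dec (Hit w)
      Hit? w = w ≟ p ⊎-dec any? λ v → E? p v ×-dec reach? S v w
      end∈ : ∀ {v w} → v ∈ S → Star (Step S) v w → w ∈ S
      end∈ v∈S π = sub (component v∈S) (reach⇒∈ (component v∈S) π)
      ¬Hit-q : ¬ Hit q
      ¬Hit-q (inj₁ q≡p) = p≢q (sym q≡p)
      ¬Hit-q (inj₂ (v , _ , v∈S , π)) = q∉S (end∈ v∈S π)
      escape : (∃ λ y → ∃ λ w → Hit y × ¬ Hit w × Step (Outside r s) y w) → ⊥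
      escape (y , w , hit , ¬hit , _ , w∈ , e) with w ∈? S | hit
      ... | yes w∈S | inj₁ refl = ¬hit (inj₂ (w , e , w∈S , ε))
      ... | yes w∈S | inj₂ (v , pv , v∈S , π) = ¬hit (inj₂ (v , pv , v∈S , π ◅◅ (end∈ v∈S π , w∈S , e) ◅ ε))
      ... | no w∉S | h with ∉S w∉S | h
      ...   | inj₁ w≡p | _ = ¬hit (inj₁ w≡p)
      ...   | inj₂ (inj₁ refl) | inj₁ refl = ¬pq e
      ...   | inj₂ (inj₁ refl) | inj₂ (v , pv , v∈S , π) = none (v , y , pv , Esym e , v∈S , π)
      ...   | inj₂ (inj₂ (inj₁ w≡r)) | _ = proj₁ (outside⁻ w∈) w≡r
      ...   | inj₂ (inj₂ (inj₂ w≡s)) | _ = proj₂ (outside⁻ {r} w∈) w≡s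

    -- A constructor lists three attachments without denying the fourth, which `not-all` excludes.
    data Type {a b c d S} (f : Frame a b c d S) {v} (K : Component-of S v) : Set where
      abc : a ~ C K → b ~ C K → c ~ C K → Type f K
      abd : a ~ C K → b ~ C K → d ~ C K → Type f K
      acd : a ~ C K → c ~ C K → d ~ C K → Type f K
      bcd : b ~ C K → c ~ C K → d ~ C K → Type f K

    module _ {a b c d S} (f : Frame a b c d S) {v} (K : Component-of S v) where
      open Frame f

      thirdᵃᵇ : c ~ C K ⊎ d ~ C K
      thirdᵃᵇ with third K a∉S b∉S c∉S a≢b (≢-sym a≢c) (≢-sym b≢c)
      ... | r , r∉ , r≢a , r≢b , t with ∉S r∉
      ...   | inj₁ p = contradiction p r≢a
      ...   | inj₂ (inj₁ p) = contradiction p r≢b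
      ...   | inj₂ (inj₂ (inj₁ refl)) = inj₁ t
      ...   | inj₂ (inj₂ (inj₂ refl)) = inj₂ t

      thirdᵃᶜ : b ~ C K ⊎ d ~ C K
      thirdᵃᶜ with third K a∉S c∉S b∉S a≢c (≢-sym a≢b) b≢c
      ... | r , r∉ , r≢a , r≢c , t with ∉S r∉
      ...   | inj₁ p = contradiction p r≢a
      ...   | inj₂ (inj₁ refl) = inj₁ t
      ...   | inj₂ (inj₂ (inj₁ p)) = contradiction p r≢c
      ...   | inj₂ (inj₂ (inj₂ refl)) = inj₂ t

      thirdᵃᵈ : b ~ C K ⊎ c ~ C K
      thirdᵃᵈ with third K a∉S d∉S b∉S a≢d (≢-sym a≢b) b≢d
      ... | r , r∉ , r≢a , r≢d , t with ∉S r∉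
      ...   | inj₁ p = contradiction p r≢a
      ...   | inj₂ (inj₁ refl) = inj₁ t
      ...   | inj₂ (inj₂ (inj₁ refl)) = inj₂ t
      ...   | inj₂ (inj₂ (inj₂ p)) = contradiction p r≢d

      thirdᵇᶜ : a ~ C K ⊎ d ~ C K
      thirdᵇᶜ with third K b∉S c∉S a∉S b≢c a≢b a≢c
      ... | r , r∉ , r≢b , r≢c , t with ∉S r∉
      ...   | inj₁ refl = inj₁ t
      ...   | inj₂ (inj₁ p) = contradiction p r≢b
      ...   | inj₂ (inj₂ (inj₁ p)) = contradiction p r≢c
      ...   | inj₂ (inj₂ (inj₂ refl)) = inj₂ t

    type : ∀ {a b c d S} (f : Frame a b c d S) {v} (K : Component-of S v) → Type f K
    type {a} {b} {c} {d} f K with a ~? C K | d ~? C K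
    ... | yes aK | yes dK = [ (λ bK → abd aK bK dK) , (λ cK → acd aK cK dK) ]′ (thirdᵃᵈ f K)
    ... | yes aK | no d≁ = abc aK ([ id , (λ dK → contradiction dK d≁) ]′ (thirdᵃᶜ f K)) ([ id , (λ dK → contradiction dK d≁) ]′ (thirdᵃᵇ f K))
    ... | no a≁ | yes dK = bcd ([ id , (λ aK → contradiction aK a≁) ]′ (thirdᵃᵇ (mirror f) K)) ([ id , (λ aK → contradiction aK a≁) ]′ (thirdᵃᶜ (mirror f) K)) dK
    ... | no a≁ | no d≁ = [ (λ aK → contradiction aK a≁) , (λ dK → contradiction dK d≁) ]′ (thirdᵇᶜ f K)

    Dominated : Subset n → Set
    Dominated W = ∃ λ h → ∀ {w} → w ∈ W → E G w h

    -- Type `abc` clashes with `K₁`, and type `bcd` with `K₂` in the mirrored frame; a component of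
    -- one remaining type is dominated by means of the given component of the other.
    abd-acd⇒dominated : ∀ {a b c d S} (f : Frame a b c d S) {v₁ v₂} (K₁ : Component-of S v₁) (K₂ : Component-of S v₂) →
      a ~ C K₁ → b ~ C K₁ → d ~ C K₁ → a ~ C K₂ → c ~ C K₂ → d ~ C K₂ →
      ∀ {v} (K : Component-of S v) → Dominated (C K)
    abd-acd⇒dominated f K₁ K₂ a₁ b₁ d₁ a₂ c₂ d₂ K with type f K
    ... | abc aK bK cK = ⊥-elim (abc-abd f K K₁ aK bK cK a₁ b₁ d₁)
    ... | bcd bK cK dK = ⊥-elim (abc-abd (mirror f) K K₂ dK cK bK d₂ c₂ a₂)
    ... | abd aK bK dK = _ , abd⇒dominated f K K₂ aK bK dK a₂ c₂ d₂
    ... | acd aK cK dK = _ , abd⇒dominated (mirror f) K K₁ dK cK aK d₁ b₁ a₁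

    -- `a` and `c` are not adjacent, so some component sees both; the given one of type `abd` leaves
    -- only `acd` for it.
    abd⇒all-dominated : ∀ {a b c d S} (f : Frame a b c d S) {v₁} (K₁ : Component-of S v₁) →
      a ~ C K₁ → b ~ C K₁ → d ~ C K₁ → ∀ {v} (K : Component-of S v) → Dominated (C K)
    abd⇒all-dominated f K₁ a₁ b₁ d₁ K
      with connect (λ w∉ → [ inj₂ ∘ inj₁ , [ inj₂ ∘ inj₂ ∘ inj₁ , [ inj₁ , inj₂ ∘ inj₂ ∘ inj₂ ]′ ]′ ]′ (Frame.∉S f w∉))
             (≢-sym (Frame.a≢c f)) (≢-sym (Frame.b≢c f)) (Frame.c≢d f) (Frame.a≢b f) (Frame.a≢d f) (Frame.b≢d f)
             (Frame.a∉S f) (Frame.¬ac f ∘ Esym)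
    ... | _ , K₂ , c₂ , a₂ with type f K₂
    ...   | abc _ b₂ _ = ⊥-elim (abc-abd f K₂ K₁ a₂ b₂ c₂ a₁ b₁ d₁)
    ...   | abd _ b₂ d₂ = ⊥-elim (not-all f K₂ a₂ b₂ c₂ d₂)
    ...   | bcd b₂ _ d₂ = ⊥-elim (not-all f K₂ a₂ b₂ c₂ d₂)
    ...   | acd _ _ d₂ = abd-acd⇒dominated f K₁ K₂ a₁ b₁ d₁ a₂ c₂ d₂ K

    -- `a` and `d` are not adjacent, so some component sees both; its type is `abd` or `acd`, and
    -- these are mirror images.
    frame⇒all-dominated : ∀ {a b c d S} → Frame a b c d S → ∀ {v} (K : Component-of S v) → Dominated (C K)
    frame⇒all-dominated f K
      with connect (λ w∉ → [ inj₁ , [ inj₂ ∘ inj₂ ∘ inj₁ , [ inj₂ ∘ inj₂ ∘ inj₂ , inj₂ ∘ inj₁ ]′ ]′ ]′ (Frame.∉S f w∉))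
             (Frame.a≢d f) (Frame.a≢b f) (Frame.a≢c f) (≢-sym (Frame.b≢d f)) (≢-sym (Frame.c≢d f)) (Frame.b≢c f)
             (Frame.d∉S f) (Frame.¬ad f)
    ... | _ , K₁ , a₁ , d₁ with type f K₁
    ...   | abc _ b₁ c₁ = ⊥-elim (not-all f K₁ a₁ b₁ c₁ d₁)
    ...   | bcd b₁ c₁ _ = ⊥-elim (not-all f K₁ a₁ b₁ c₁ d₁)
    ...   | abd _ b₁ _ = abd⇒all-dominated f K₁ a₁ b₁ d₁ K
    ...   | acd _ c₁ _ = abd⇒all-dominated (mirror f) K₁ d₁ c₁ a₁ K

  -- The final case distinction

  frame : ∀ {a b c d} → E G a b → E G b c → E G c d → ¬ E G a c → ¬ E G b d → ¬ E G a d →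
    Frame a b c d (∁ (⁅ a ⁆ ∪ ⁅ b ⁆ ∪ ⁅ c ⁆ ∪ ⁅ d ⁆))
  frame {a} {b} {c} {d} ab bc cd ¬ac ¬bd ¬ad = record
    { ab = ab ; bc = bc ; cd = cd ; ¬ac = ¬ac ; ¬bd = ¬bd ; ¬ad = ¬ad
    ; in⁺ = λ w≢a w≢b w≢c w≢d → x∉p⇒x∈∁p
        (∪-elim (w≢a ∘ ⁅⁆-elim) (∪-elim (w≢b ∘ ⁅⁆-elim) (∪-elim (w≢c ∘ ⁅⁆-elim) (w≢d ∘ ⁅⁆-elim))))
    ; a∉S = λ p → x∈∁p⇒x∉p p (∪ˡ (x∈⁅x⁆ a))
    ; b∉S = λ p → x∈∁p⇒x∉p p (∪ʳ {p = ⁅ a ⁆} (∪ˡ (x∈⁅x⁆ b)))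
    ; c∉S = λ p → x∈∁p⇒x∉p p (∪ʳ {p = ⁅ a ⁆} (∪ʳ {p = ⁅ b ⁆} (∪ˡ (x∈⁅x⁆ c))))
    ; d∉S = λ p → x∈∁p⇒x∉p p (∪ʳ {p = ⁅ a ⁆} (∪ʳ {p = ⁅ b ⁆} (∪ʳ {p = ⁅ c ⁆} (x∈⁅x⁆ d))))
    }

  no-cut : ¬ Cut → Result
  no-cut ¬cut
    with any? (λ a → any? λ b → any? λ c → any? λ d →
           E? a b ×-dec E? b c ×-dec E? c d ×-dec ¬? (E? a c) ×-dec ¬? (E? b d) ×-dec ¬? (E? a d))
  ... | no none = ∅ , ℕ.≤-trans (ℕ.≤-reflexive (∣⊥∣≡0 n)) z≤n ,
        λ v _ → inj₁ λ { (a , b , c , d , _ , _ , _ , _ , p4) → none (a , b , c , d , p4) }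
  ... | yes (a , b , c , d , ab , bc , cd , ¬ac , ¬bd , ¬ad) =
    finish (⁅ a ⁆ ∪ ⁅ b ⁆ ∪ ⁅ c ⁆ ∪ ⁅ d ⁆) bound λ v v∉ →
      component (x∉p⇒x∈∁p v∉) ,
      inj₁ (frame⇒all-dominated ¬cut (frame ab bc cd ¬ac ¬bd ¬ad) (component (x∉p⇒x∈∁p v∉)))
    where
    bound : ∣ ⁅ a ⁆ ∪ ⁅ b ⁆ ∪ ⁅ c ⁆ ∪ ⁅ d ⁆ ∣ ≤ 6
    bound = ℕ.≤-trans (∣⁅x⁆∪q∣≤ a (∣⁅x⁆∪q∣≤ b (∣⁅x⁆∪q∣≤ c (ℕ.≤-reflexive (∣⁅x⁆∣≡1 d))))) (s≤s (s≤s (s≤s (s≤s z≤n))))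

  result : Result
  result with AdjacentCut? | TripleCut? | Cut?
  ... | yes (_ , _ , _ , _ , x≢z , e , sep) | _ | _ = adjacent-cut x≢z e sep
  ... | no _ | yes (_ , _ , _ , _ , _ , x≢z , uw , ut , wt) | _ = triple-cut x≢z uw ut wt
  ... | no ¬adjacent | no ¬triple | yes cut = thin-cut ¬adjacent ¬triple cut
  ... | no _ | no _ | no ¬cut = no-cut ¬cut

mainTheorem3 : (n : ℕ) (G : Adj n) → IsSimple G → TwoConnected G → ¬ (Gem ≼ G) →
    Σ (Subset n) λ X → ∣ X ∣ ≤ 6 ×
    ((v : Fin n) → v ∉ X →
    IsCographOn G (Component G X v) ⊎ IsPathDeg2On G (Component G X v))
mainTheorem3 n G simple two gemFree = GemFreeGraph.result G simple gemFree two
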